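{- If $D$ is a locally in-semicomplete CKI-digraph or a locally out-semicomplete CKI-digraph, then $D$ is a directed odd cycle, $D\cong \overrightarrow{C}_7(1,2)$, or $D\cong \overrightarrow{C}_n(1,\pm2,\pm3,\dots,\pm\lfloor \frac{n}{2}\rfloor)$ for some $n\ge4$.
   Context: Digraphs are finite, without loops or parallel arcs; both arcs $uv$ and $vu$ may be present. A digraph is semicomplete if every two distinct vertices are joined by at least one arc. $D$ is locally in-semicomplete (resp. locally out-semicomplete) if for every vertex $v$ the in-neighbourhood $N^-(v)$ (resp. out-neighbourhood $N^+(v)$) induces a semicomplete subdigraph. A kernel is a set $S$ of vertices that is independent (no arc between two vertices of $S$) and absorbent (every vertex outside $S$ has an arc into $S$). $D$ is a CKI-digraph if $D$ has no kernel but every proper induced subdigraph has a kernel. For nonempty $J\subseteq\mathbb{Z}_m\setminus\{0\}$, $\overrightarrow{C}_m(J)$ has vertex set $\mathbb{Z}_m$ and arcs $(i,j)$ with $j-i\in J$; $\overrightarrow{C}_7(1,2)$ has $J=\{1,2\}$ and $\overrightarrow{C}_n(1,\pm2,\dots,\pm\lfloor n/2\rfloor)$ has $J=\{1\}\cup\{\pm k:2\le k\le\lfloor n/2\rfloor\}$. -}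

module Defs where

open import Data.Nat using (ℕ; zero; suc; _+_; _≤_; _<_; _/_)
open import Data.Fin using (Fin; toℕ)
open import Data.Bool using (Bool; true; false; T)
open import Data.Product using (Σ; _×_; ∃; ∃-syntax; _,_)
open import Data.Sum using (_⊎_)
open import Relation.Nullary using (¬_)
open import Relation.Binary.PropositionalEquality using (_≡_)
open import Function.Bundles using (_↔_; _⇔_; Inverse)

record Digraph (n : ℕ) : Set where
  field
    adj      : Fin n → Fin n → Bool
    loopless : ∀ v → adj v v ≡ false

open Digraph public

Arc : ∀ {n} → Digraph n → Fin n → Fin n → Set
Arc D u v = T (adj D u v)

LocallyInSemicomplete : ∀ {n} → Digraph n → Set
LocallyInSemicomplete {n} D =
  ∀ (v x y : Fin n) → Arc D x v → Arc D y v → ¬ x ≡ y → Arc D x y ⊎ Arc D y x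

LocallyOutSemicomplete : ∀ {n} → Digraph n → Set
LocallyOutSemicomplete {n} D =
  ∀ (v x y : Fin n) → Arc D v x → Arc D v y → ¬ x ≡ y → Arc D x y ⊎ Arc D y x

VSet : ℕ → Set
VSet n = Fin n → Bool

IsKernelIn : ∀ {n} → Digraph n → VSet n → VSet n → Set
IsKernelIn {n} D P S =
  (∀ u → T (S u) → T (P u)) ×
  (∀ u v → T (S u) → T (S v) → ¬ Arc D u v) ×
  (∀ u → T (P u) → ¬ T (S u) → ∃[ v ] (T (S v) × Arc D u v))

HasKernelIn : ∀ {n} → Digraph n → VSet n → Set
HasKernelIn D P = ∃[ S ] IsKernelIn D P S

full : ∀ {n} → VSet n
full _ = true

HasKernel : ∀ {n} → Digraph n → Set
HasKernel D = HasKernelIn D full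

CKI : ∀ {n} → Digraph n → Set
CKI {n} D =
  ¬ HasKernel D ×
  (∀ (P : VSet n) → (∃[ u ] ¬ T (P u)) → HasKernelIn D P)

-- Circulant digraph C_m(J) on Z_m ≅ Fin m, with J given as a predicate on
-- residues d ∈ {1,…,m-1}: arc (i,j) iff j - i ≡ d (mod m) for some d ∈ J.
CircArc : (m : ℕ) → (ℕ → Set) → Fin m → Fin m → Set
CircArc m J i j =
  ∃[ d ] (J d × 1 ≤ d × d < m ×
          (toℕ i + d ≡ toℕ j ⊎ toℕ i + d ≡ toℕ j + m))

IsoCirc : ∀ {n} → Digraph n → (m : ℕ) → (ℕ → Set) → Set
IsoCirc {n} D m J =
  Σ (Fin n ↔ Fin m) λ f →
    ∀ u v → Arc D u v ⇔ CircArc m J (Inverse.to f u) (Inverse.to f v)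

J-cycle : ℕ → Set
J-cycle d = d ≡ 1

J-1-2 : ℕ → Set
J-1-2 d = d ≡ 1 ⊎ d ≡ 2

-- J = {1} ∪ {±k : 2 ≤ k ≤ ⌊m/2⌋} as residues mod m
J-big : ℕ → ℕ → Set
J-big m d = d ≡ 1 ⊎ (∃[ k ] (2 ≤ k × k ≤ m / 2 × (d ≡ k ⊎ d + k ≡ m)))

IsDirectedOddCycle : ∀ {n} → Digraph n → Set
IsDirectedOddCycle D = ∃[ k ] IsoCirc D (suc (suc (suc (k + k)))) J-cycle

{-# OPTIONS --safe #-}
-- Let S v be a kernel of D − v. If D is locally in-semicomplete, exactly one vertex f v of S v has
-- an arc to v. Every vertex has at most one in-neighbour in S v, so the arcs between S v and
-- S (f v), together with v, contain a directed cycle v → β k → α k → … → β 0 → α 0 = f v → v of odd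
-- length whose only possible chord is β 0 = f (f v) → v; without it D is an odd cycle. If k = 0 for
-- all v, a shortest non-arc f ᵈ x ↛ x spans a semicomplete digraph without kernel. Otherwise the
-- cycles of v and f v fit together: k is the same and the vertices β of the first cycle are the
-- vertices α of the second. Comparing consecutive cycles yields an odd hole, or k = 1 and C₇(1,2).
--
-- If D is locally out-semicomplete, every vertex u ≠ v outside S v has exactly one out-neighbour in
-- S v, that is (A + I) S = J − I. Linear algebra turns this into S (A + I) = J − I, so the sets
-- {v : u ∈ S v} play the role of the kernels for the reversed digraph.
module Submission where

open import Defs
open import Data.Nat using (ℕ; _≤_)
open import Data.Product using (_×_; ∃-syntax)
open import Data.Sum using (_⊎_)

open import Algebra.Bundles using (CommutativeRing)
open import Data.Bool using (Bool; true; false; T; not; _∧_; _∨_)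
open import Data.Bool.Properties using (T?)
open import Data.Empty using (⊥; ⊥-elim)
open import Data.Fin using (Fin; zero; suc; toℕ; fromℕ<; opposite; punchIn; punchOut)
open import Data.Fin.Patterns
open import Data.Fin.Properties
  using (_≟_; all?; any?; pigeonhole; punchInᵢ≢i; punchOut-injective; injective⇒≤; ¬Fin0
        ; toℕ-injective; toℕ<n; toℕ-fromℕ<; opposite-prop; opposite-involutive)
open import Data.Integer using (ℤ; 0ℤ; 1ℤ; ≢-nonZero)
  renaming (+_ to pos; _+_ to _+ᶻ_; _*_ to _*ᶻ_; -_ to -ᶻ_; _≟_ to _≟ᶻ_)
import Data.Integer.Properties as ℤₚ
import Data.Integer.Tactic.RingSolver as ℤ-Solver
open import Data.Nat using (zero; suc; _+_; _*_; _∸_; _<_; _/_; _%_; z≤n; s≤s; s≤s⁻¹; _≤?_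
                           ; compare; less; equal; greater)
open import Data.Nat.DivMod using (m/n*n≤m; m≡m%n+[m/n]*n; m%n<n)
import Data.Nat.Properties as ℕₚ
open import Data.Nat.Properties using (≤-refl; ≤-trans; n≤1+n; m≤n⇒m<n∨m≡n; 1+n≰n)
open import Data.Nat.Tactic.RingSolver using (solve-∀)
open import Data.Product using (_,_; proj₁; proj₂)
open import Data.Sum as Sum using (inj₁; inj₂)
open import Data.Unit using (tt)
open import Data.Vec.Functional using (insertAt)
open import Data.Vec.Functional.Properties using (insertAt-lookup; insertAt-punchIn)
open import Function using (_∘_)
open import Function.Bundles using (_⇔_; mk⇔; mk↔ₛ′; Equivalence)
open import Relation.Binary.PropositionalEquality
  using (_≡_; _≢_; refl; sym; trans; cong; cong₂; subst; subst₂; module ≡-Reasoning)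
open import Relation.Nullary using (¬_; Dec; yes; no; does)
open import Relation.Nullary.Decidable using (_×-dec_; _⊎-dec_; _→-dec_; ¬?; map′; from-yes)

open import Algebra.Properties.Semiring.Sum (CommutativeRing.semiring ℤₚ.+-*-commutativeRing)
  using (sum; sum-remove; ∑-comm; ∑-distrib-+; *-distribˡ-sum; *-distribʳ-sum; sum-cong-≗; sum-replicate-zero)

-- Kernel systems of locally in-semicomplete digraphs

-- Local in-semicompleteness bounds in-neighbours only, while tracing the cycle needs in-neighbours
-- to exist, and excluding chords needs out-neighbours to be unique. Both come from counting: the
-- arcs that absorption supplies between `S v` and `S (f v)`, completed by `f v ↦ y` for an
-- out-neighbour `y` of `v` in `S (f v)` and by fixed points, form an injective self-map of a finite
-- set, hence a permutation.
--
-- The argument is carried by a `KernelSystem` rather than by criticality. The reversed digraph is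
-- not known to be a CKI-digraph, but in the out-semicomplete case it has a kernel system, which
-- suffices to find an embedded circulant. Criticality of `D` returns at the end to make the
-- embedding onto; circulants are isomorphic to their reverses, so the direction does not matter.
--
-- The linear algebra yields only that `S (A + I) + I` has rank one. That its off-diagonal entries
-- are 1 is due to integrality: opposite entries are natural numbers with product 1.

infix 4 _∈_ _∉_

_∈_ _∉_ : ∀ {n} → Fin n → VSet n → Set
u ∈ S = T (S u)
u ∉ S = ¬ u ∈ S

injective⇒surjective : ∀ {n} (g : Fin n → Fin n) → (∀ {x y} → g x ≡ g y → x ≡ y) →
                       ∀ z → ∃[ x ] g x ≡ z
injective⇒surjective {suc n} g inj z with any? (λ x → g x ≟ z)
... | yes hit = hit
... | no miss = ⊥-elim (1+n≰n (injective⇒≤ {f = λ x → punchOut (avoid x)}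
                  λ {x} {y} eq → inj (punchOut-injective (avoid x) (avoid y) eq)))
  where
  avoid : ∀ x → z ≢ g x
  avoid x z≡gx = miss (x , sym z≡gx)

-- S v is a kernel of D − v. In a digraph without kernel it does not absorb v, and S v ∪ {v}
-- is not independent, which yields the arc from f v to v.
record KernelSystem {n} (D : Digraph n) : Set where
  field
    S      : Fin n → VSet n
    f      : Fin n → Fin n
    indep  : ∀ v {a b} → a ∈ S v → b ∈ S v → ¬ Arc D a b
    unabs  : ∀ v {s} → s ∈ S v → ¬ Arc D v s
    absorb : ∀ v {u} → u ≢ v → u ∉ S v → ∃[ s ] (s ∈ S v × Arc D u s)
    f∈     : ∀ v → f v ∈ S v
    f→     : ∀ v → Arc D (f v) v

loop-free : ∀ {n} (D : Digraph n) {u v} → Arc D u v → u ≢ v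
loop-free D {u} u→u refl = subst T (loopless D u) u→u

cki⇒kernelSystem : ∀ {n} (D : Digraph n) → CKI D → KernelSystem D
cki⇒kernelSystem {n} D (noKernel , hereditary) = record
  { S = K ; f = λ v → proj₁ (entry v) ; indep = indepK ; unabs = unabsK ; absorb = absorbK
  ; f∈ = λ v → proj₁ (proj₂ (entry v)) ; f→ = λ v → proj₂ (proj₂ (entry v)) }
  where
  _-v : Fin n → VSet n
  (v -v) u = not (does (u ≟ v))

  off : ∀ v {u} → u ≢ v → u ∈ (v -v)
  off v {u} u≢v with u ≟ v
  ... | yes u≡v = u≢v u≡v
  ... | no _    = tt

  v∉ : ∀ v → v ∉ (v -v)
  v∉ v p with v ≟ v
  ... | no v≢v = v≢v refl

  kernel : ∀ v → HasKernelIn D (v -v)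
  kernel v = hereditary (v -v) (v , v∉ v)

  K : Fin n → VSet n
  K v = proj₁ (kernel v)

  indepK : ∀ v {a b} → a ∈ K v → b ∈ K v → ¬ Arc D a b
  indepK v a∈ b∈ = proj₁ (proj₂ (proj₂ (kernel v))) _ _ a∈ b∈

  absorbK : ∀ v {u} → u ≢ v → u ∉ K v → ∃[ s ] (s ∈ K v × Arc D u s)
  absorbK v u≢v u∉ = proj₂ (proj₂ (proj₂ (kernel v))) _ (off v u≢v) u∉

  unabsK : ∀ v {s} → s ∈ K v → ¬ Arc D v s
  unabsK v {s} s∈ v→s = noKernel (K v , (λ _ _ → tt) , (λ _ _ → indepK v) , abs)
    where
    abs : ∀ u → T true → u ∉ K v → ∃[ t ] (t ∈ K v × Arc D u t)
    abs u _ u∉ with u ≟ v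
    ... | yes refl = s , s∈ , v→s
    ... | no u≢v   = absorbK v u≢v u∉

  entry : ∀ v → ∃[ s ] (s ∈ K v × Arc D s v)
  entry v with any? (λ s → T? (K v s) ×-dec T? (adj D s v))
  ... | yes found = found
  ... | no none   = ⊥-elim (noKernel (K⁺ , (λ _ _ → tt) , ind , abs))
    where
    K⁺ : VSet n
    K⁺ u = does (u ≟ v) ∨ K v u

    ind : ∀ a b → a ∈ K⁺ → b ∈ K⁺ → ¬ Arc D a b
    ind a b a∈ b∈ a→b with a ≟ v | b ≟ v
    ... | yes refl | yes refl = loop-free D a→b refl
    ... | yes refl | no _     = unabsK v b∈ a→b
    ... | no _     | yes refl = none (a , a∈ , a→b)
    ... | no _     | no _     = indepK v a∈ b∈ a→b

    K⊆ : ∀ {s} → s ∈ K v → s ∈ K⁺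
    K⊆ {s} s∈ with s ≟ v
    ... | yes _ = tt
    ... | no _  = s∈

    abs : ∀ u → T true → u ∉ K⁺ → ∃[ t ] (t ∈ K⁺ × Arc D u t)
    abs u _ u∉ with u ≟ v
    ... | yes refl = ⊥-elim (u∉ tt)
    ... | no u≢v   = let s , s∈ , u→s = absorbK v u≢v u∉ in s , K⊆ s∈ , u→s

module InSystem {n} (D : Digraph n) (insemi : LocallyInSemicomplete D) (sys : KernelSystem D) where
  open KernelSystem sys public

  infix 4 _⟶_
  _⟶_ : Fin n → Fin n → Set
  u ⟶ v = Arc D u v

  self∉ : ∀ v → v ∉ S v
  self∉ v v∈ = indep v (f∈ v) v∈ (f→ v)

  uniqueIn : ∀ z {a b t} → a ∈ S z → b ∈ S z → a ⟶ t → b ⟶ t → a ≡ b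
  uniqueIn z {a} {b} {t} a∈ b∈ a→t b→t with a ≟ b
  ... | yes a≡b = a≡b
  ... | no a≢b with insemi t a b a→t b→t a≢b
  ...   | inj₁ a→b = ⊥-elim (indep z a∈ b∈ a→b)
  ...   | inj₂ b→a = ⊥-elim (indep z b∈ a∈ b→a)

  apart : ∀ z {a b} → a ∈ S z → b ∉ S z → a ≢ b
  apart _ a∈ b∉ refl = b∉ a∈

  asym : ∀ v → ¬ v ⟶ f v
  asym v = unabs v (f∈ v)

  into-v : ∀ v {s} → s ∈ S v → s ⟶ v → s ≡ f v
  into-v v s∈ s→v = uniqueIn v s∈ (f∈ v) s→v (f→ v)

  module Pair (v : Fin n) where
    w : Fin n
    w = f v

    v∉ : v ∉ S w
    v∉ v∈ = unabs w v∈ (f→ v)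

    entrance : ∃[ s ] (s ∈ S w × v ⟶ s)
    entrance = absorb w (apart v (f∈ v) (self∉ v) ∘ sym) v∉

    y : Fin n
    y = proj₁ entrance
    y∈ : y ∈ S w
    y∈ = proj₁ (proj₂ entrance)
    v→y : v ⟶ y
    v→y = proj₂ (proj₂ entrance)

    out∉ : ∀ {s} → v ⟶ s → s ∉ S v
    out∉ v→s s∈ = unabs v s∈ v→s

    -- `a` and `v` would both be in-neighbours of `s`, hence adjacent; `a → v` forces `a = w`, which
    -- has no arc into `S w`. This leaves `y` free to be the image of `w` in the permutation below.
    source : ∀ {s a} → s ∈ S w → v ⟶ s → a ∈ S v → ¬ a ⟶ s
    source {s} {a} s∈ v→s a∈ a→s with insemi s a v a→s v→s (apart v a∈ (self∉ v))
    ... | inj₁ a→v = unabs w s∈ (subst (_⟶ s) (into-v v a∈ a→v) a→s)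
    ... | inj₂ v→a = unabs v a∈ v→a

    -- The arcs between S v and S w, completed to a permutation of the vertices.
    data _↦_ (x z : Fin n) : Set where
      down  : x ∈ S v → z ∈ S w → x ⟶ z → x ↦ z
      up    : x ∈ S w → z ∈ S v → x ⟶ z → x ↦ z
      close : x ≡ w → z ≡ y → x ↦ z
      stay  : x ≡ z → (z ∈ S v → z ∈ S w) → (z ∈ S w → z ∈ S v) → x ↦ z

    image : ∀ x → ∃[ z ] x ↦ z
    image x with T? (S v x) | T? (S w x)
    ... | yes x∈v | yes x∈w = x , stay refl (λ _ → x∈w) (λ _ → x∈v)
    ... | no x∉v  | no x∉w  = x , stay refl (⊥-elim ∘ x∉v) (⊥-elim ∘ x∉w)
    ... | no x∉v  | yes x∈w =
      let s , s∈ , x→s = absorb v (apart w x∈w v∉) x∉v in s , up x∈w s∈ x→s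
    ... | yes x∈v | no x∉w with x ≟ w
    -- `S w` absorbs every vertex outside it except `w`; the spare target is `y`, which no vertex of
    -- `S v` points to.
    ...   | yes x≡w = y , close x≡w refl
    ...   | no x≢w  = let s , s∈ , x→s = absorb w x≢w x∉w in s , down x∈v s∈ x→s

    y∉ : y ∉ S v
    y∉ = out∉ v→y

    ↦-injective : ∀ {x x′ z} → x ↦ z → x′ ↦ z → x ≡ x′
    ↦-injective (down p q r) (down p′ q′ r′) = uniqueIn v p p′ r r′
    ↦-injective (up p q r) (up p′ q′ r′) = uniqueIn w p p′ r r′
    ↦-injective (close refl _) (close refl _) = refl
    ↦-injective (stay refl _ _) (stay refl _ _) = refl
    ↦-injective (down p q r) (up p′ q′ r′) = ⊥-elim (indep v p q′ r)
    ↦-injective (up p q r) (down p′ q′ r′) = ⊥-elim (indep v p′ q r′)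
    ↦-injective (down p q r) (close _ refl) = ⊥-elim (source y∈ v→y p r)
    ↦-injective (close _ refl) (down p q r) = ⊥-elim (source y∈ v→y p r)
    ↦-injective (down p q r) (stay _ _ b) = ⊥-elim (indep v p (b q) r)
    ↦-injective (stay _ _ b) (down p q r) = ⊥-elim (indep v p (b q) r)
    ↦-injective (up p q r) (close _ refl) = ⊥-elim (y∉ q)
    ↦-injective (close _ refl) (up p q r) = ⊥-elim (y∉ q)
    ↦-injective (up p q r) (stay _ a _) = ⊥-elim (indep w p (a q) r)
    ↦-injective (stay _ a _) (up p q r) = ⊥-elim (indep w p (a q) r)
    ↦-injective (close _ refl) (stay _ _ b) = ⊥-elim (y∉ (b y∈))
    ↦-injective (stay _ _ b) (close _ refl) = ⊥-elim (y∉ (b y∈))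

    preimage : ∀ z → ∃[ x ] proj₁ (image x) ≡ z
    preimage = injective⇒surjective (proj₁ ∘ image)
      λ {x} {x′} eq → ↦-injective (proj₂ (image x)) (subst (x′ ↦_) (sym eq) (proj₂ (image x′)))

    predecessor : ∀ z → ∃[ x ] x ↦ z
    predecessor z = let x , eq = preimage z in x , subst (x ↦_) eq (proj₂ (image x))

    -- Surjectivity of the permutation turns absorption, a statement about out-neighbours, into
    -- existence of in-neighbours.
    predA : ∀ {a} → a ∈ S v → a ∉ S w → ∃[ b ] (b ∈ S w × b ⟶ a)
    predA {a} a∈ a∉ with predecessor a
    ... | x , down _ q _   = ⊥-elim (a∉ q)
    ... | x , up p _ r     = x , p , r
    ... | x , close _ refl = ⊥-elim (y∉ a∈)
    ... | x , stay _ h _   = ⊥-elim (a∉ (h a∈))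

    predB : ∀ {b} → b ∈ S w → b ∉ S v → b ≡ y ⊎ ∃[ a ] (a ∈ S v × a ⟶ b)
    predB {b} b∈ b∉ with predecessor b
    ... | x , down p _ r = inj₂ (x , p , r)
    ... | x , up _ q _   = ⊥-elim (b∉ q)
    ... | x , close _ eq = inj₁ eq
    ... | x , stay _ _ h = ⊥-elim (b∉ (h b∈))

    -- `b` has a preimage under the permutation, and by `uniqueIn` this is `a`; so every such `b` is
    -- the chosen image of `a`.
    outA : ∀ {a b b′} → a ∈ S v → b ∈ S w → b′ ∈ S w → a ⟶ b → a ⟶ b′ → b ≡ b′
    outA {a} a∈ b∈ b′∈ a→b a→b′ = trans (only b∈ a→b) (sym (only b′∈ a→b′))
      where
      only : ∀ {b} → b ∈ S w → a ⟶ b → b ≡ proj₁ (image a)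
      only {b} b∈ a→b with preimage b
      ... | x , eq with subst (x ↦_) eq (proj₂ (image x))
      ...   | down p _ r    = trans (sym eq) (cong (proj₁ ∘ image) (uniqueIn v p a∈ r a→b))
      ...   | up _ q _      = ⊥-elim (indep v a∈ q a→b)
      ...   | close _ refl  = ⊥-elim (source y∈ v→y a∈ a→b)
      ...   | stay _ _ h    = ⊥-elim (indep v a∈ (h b∈) a→b)

    outB : ∀ {b a a′} → b ∈ S w → a ∈ S v → a′ ∈ S v → b ⟶ a → b ⟶ a′ → a ≡ a′
    outB {b} b∈ a∈ a′∈ b→a b→a′ = trans (only a∈ b→a) (sym (only a′∈ b→a′))
      where
      only : ∀ {a} → a ∈ S v → b ⟶ a → a ≡ proj₁ (image b)
      only {a} a∈ b→a with preimage a
      ... | x , eq with subst (x ↦_) eq (proj₂ (image x))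
      ...   | down _ q _    = ⊥-elim (indep w b∈ q b→a)
      ...   | up p _ r      = trans (sym eq) (cong (proj₁ ∘ image) (uniqueIn w p b∈ r b→a))
      ...   | close _ refl  = ⊥-elim (y∉ a∈)
      ...   | stay _ h _    = ⊥-elim (indep w b∈ (h a∈) b→a)

    v-out : ∀ {s s′} → s ∈ S w → s′ ∈ S w → v ⟶ s → v ⟶ s′ → s ≡ s′
    v-out s∈ s′∈ v→s v→s′ = trans (is-y s∈ v→s) (sym (is-y s′∈ v→s′))
      where
      is-y : ∀ {s} → s ∈ S w → v ⟶ s → s ≡ y
      is-y s∈ v→s with predB s∈ (out∉ v→s)
      ... | inj₁ s≡y            = s≡y
      ... | inj₂ (a , a∈ , a→s) = ⊥-elim (source s∈ v→s a∈ a→s)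

    -- `s` and `w` are both in-neighbours of `v`, hence adjacent, and `w` has no arc into `S w`.
    v-in : ∀ {s} → s ∈ S w → s ⟶ v → s ≡ f w
    v-in {s} s∈ s→v with insemi v s w s→v (f→ v) (apart w s∈ (self∉ w))
    ... | inj₁ s→w = into-v w s∈ s→w
    ... | inj₂ w→s = ⊥-elim (unabs w s∈ w→s)

  -- An alternating walk traced backwards from `f v`, not yet closed through `v`: its injectivity is
  -- what shows that the tracing stops. Values of `α` and `β` beyond `k` carry no information.
  record Chain (v : Fin n) (k : ℕ) (α β : ℕ → Fin n) : Set where
    field
      α₀  : α 0 ≡ f v
      α∈  : ∀ {j} → j ≤ k → α j ∈ S v
      β∈  : ∀ {j} → j ≤ k → β j ∈ S (f v)
      β→α : ∀ {j} → j ≤ k → β j ⟶ α j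
      α→β : ∀ {j} → j < k → α (suc j) ⟶ β j

    open Pair v

    α∉ : ∀ {j} → j ≤ k → α j ∉ S w
    α∉ j≤k α∈w = indep w (β∈ j≤k) α∈w (β→α j≤k)

    β∉ : ∀ {j} → j ≤ k → β j ∉ S v
    β∉ j≤k β∈v = indep v β∈v (α∈ j≤k) (β→α j≤k)

    -- An equality is pushed along the unique forward arcs until one index is 0, and `α 0 = w` has
    -- no arc into `S w`.
    α-injective : ∀ {i j} → i ≤ k → j ≤ k → α i ≡ α j → i ≡ j
    α-injective {zero}  {zero}  _ _ _ = refl
    α-injective {zero}  {suc j} _ j<k eq =
      ⊥-elim (unabs w (β∈ (ℕₚ.<⇒≤ j<k)) (subst (_⟶ β j) (trans (sym eq) α₀) (α→β j<k)))
    α-injective {suc i} {zero} i<k _ eq =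
      ⊥-elim (unabs w (β∈ (ℕₚ.<⇒≤ i<k)) (subst (_⟶ β i) (trans eq α₀) (α→β i<k)))
    α-injective {suc i} {suc j} i<k j<k eq = cong suc (α-injective i≤k j≤k
      (outB (β∈ i≤k) (α∈ i≤k) (α∈ j≤k) (β→α i≤k) (subst (_⟶ α j) (sym βs) (β→α j≤k))))
      where
      i≤k = ℕₚ.<⇒≤ i<k
      j≤k = ℕₚ.<⇒≤ j<k
      βs : β i ≡ β j
      βs = outA (α∈ i<k) (β∈ i≤k) (β∈ j≤k) (α→β i<k) (subst (_⟶ β j) (sym eq) (α→β j<k))

    β-injective : ∀ {i j} → i ≤ k → j ≤ k → β i ≡ β j → i ≡ j
    β-injective {i} {j} i≤k j≤k eq = α-injective i≤k j≤k
      (outB (β∈ i≤k) (α∈ i≤k) (α∈ j≤k) (β→α i≤k) (subst (_⟶ α j) (sym eq) (β→α j≤k)))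

    β₀ : β 0 ≡ f w
    β₀ = into-v w (β∈ z≤n) (subst (β 0 ⟶_) α₀ (β→α z≤n))

    in-α : ∀ {j s} → j ≤ k → s ∈ S w → s ⟶ α j → s ≡ β j
    in-α j≤k s∈ s→α = uniqueIn w s∈ (β∈ j≤k) s→α (β→α j≤k)

    out-α : ∀ {j s} → j ≤ k → s ∈ S w → α j ⟶ s → ∃[ i ] (j ≡ suc i × s ≡ β i)
    out-α {zero}  {s} _ s∈ α→s = ⊥-elim (unabs w s∈ (subst (_⟶ s) α₀ α→s))
    out-α {suc i} j≤k s∈ α→s =
      i , refl , outA (α∈ j≤k) s∈ (β∈ (ℕₚ.<⇒≤ j≤k)) α→s (α→β j≤k)

    out-β : ∀ {j s} → j ≤ k → s ∈ S v → β j ⟶ s → s ≡ α j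
    out-β j≤k s∈ β→s = outB (β∈ j≤k) s∈ (α∈ j≤k) β→s (β→α j≤k)

  -- The closing arc makes the chain a cycle of length `2k + 3` through `v`.
  record Path (v : Fin n) (k : ℕ) (α β : ℕ → Fin n) : Set where
    field
      chain : Chain v k α β
      last  : v ⟶ β k
    open Chain chain public
    open Pair v using (source; v-out; v-in)

    in-β : ∀ {j s} → j ≤ k → s ∈ S v → s ⟶ β j → j < k × s ≡ α (suc j)
    in-β j≤k s∈ s→β with m≤n⇒m<n∨m≡n j≤k
    ... | inj₁ j<k  = j<k , uniqueIn v s∈ (α∈ j<k) s→β (α→β j<k)
    ... | inj₂ refl = ⊥-elim (source (β∈ j≤k) last s∈ s→β)

    v→⇒β : ∀ {s} → s ∈ S (f v) → v ⟶ s → s ≡ β k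
    v→⇒β s∈ v→s = v-out s∈ (β∈ ≤-refl) v→s last

    →v⇒β : ∀ {s} → s ∈ S (f v) → s ⟶ v → s ≡ β 0
    →v⇒β s∈ s→v = trans (v-in s∈ s→v) (sym β₀)

    v-α : ∀ {j} → j ≤ k → ¬ v ⟶ α j
    v-α j≤k = unabs v (α∈ j≤k)

    α-v : ∀ {j} → j ≤ k → α j ⟶ v → j ≡ 0
    α-v j≤k α→v = α-injective j≤k z≤n (trans (into-v v (α∈ j≤k) α→v) (sym α₀))

  least : ∀ {P : ℕ → Set} → (∀ i → Dec (P i)) → ∀ m →
          (∀ i → i < m → ¬ P i) ⊎ ∃[ k ] (P k × ∀ i → i < k → ¬ P i)
  least P? zero = inj₁ λ _ ()
  least P? (suc m) with least P? m
  ... | inj₂ found = inj₂ found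
  ... | inj₁ none with P? m
  ...   | yes p = inj₂ (m , p , none)
  ...   | no ¬p = inj₁ λ i i<1+m p → case (m≤n⇒m<n∨m≡n (s≤s⁻¹ i<1+m)) p
    where
    case : ∀ {i} → i < m ⊎ i ≡ m → ¬ _
    case (inj₁ i<m)  = none _ i<m
    case (inj₂ refl) = ¬p

  -- The walk is stopped at the first `β j = y`. It does stop, since otherwise `α 0, …, α n` would
  -- be `n + 1` distinct vertices.
  path : ∀ v → ∃[ k ] ∃[ α ] ∃[ β ] Path v k α β
  path v = build (least (λ j → βs j ≟ y) (suc n))
    where
    open Pair v

    pick : (P : VSet n) → Fin n → Fin n
    pick P z with any? (λ x → T? (P x) ×-dec T? (adj D x z))
    ... | yes (x , _) = x
    -- A dummy value: `pick-spec` covers the arguments for which an in-neighbour exists.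
    ... | no _        = z

    pick-spec : ∀ P z → ∃[ x ] (x ∈ P × x ⟶ z) → pick P z ∈ P × pick P z ⟶ z
    pick-spec P z e with any? (λ x → T? (P x) ×-dec T? (adj D x z))
    ... | yes (x , p) = p
    ... | no ¬e       = ⊥-elim (¬e e)

    αs βs : ℕ → Fin n
    αs zero    = w
    αs (suc j) = pick (S v) (βs j)
    βs j       = pick (S w) (αs j)

    w∉ : w ∉ S w
    w∉ = self∉ w

    βs-spec : ∀ j → αs j ∈ S v → αs j ∉ S w → βs j ∈ S w × βs j ⟶ αs j
    βs-spec j α∈ α∉ = pick-spec (S w) _ (predA α∈ α∉)

    αs-spec : ∀ j → βs j ∈ S w → βs j ∉ S v → βs j ≢ y → αs (suc j) ∈ S v × αs (suc j) ⟶ βs j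
    αs-spec j β∈ β∉ β≢y with predB β∈ β∉
    ... | inj₁ β≡y = ⊥-elim (β≢y β≡y)
    ... | inj₂ e   = pick-spec (S v) (βs j) e

    α-inv : ∀ j → (∀ i → i < j → βs i ≢ y) → αs j ∈ S v × αs j ∉ S w
    α-inv zero    _  = f∈ v , w∉
    α-inv (suc j) go =
      let α∈ , α∉ = α-inv j (λ i i<j → go i (≤-trans i<j (n≤1+n j)))
          β∈ , β→α = βs-spec j α∈ α∉
          α∈′ , α→β = αs-spec j β∈ (λ β∈v → indep v β∈v α∈ β→α) (go j ≤-refl)
      in α∈′ , λ α∈w → indep w α∈w β∈ α→β

    mkChain : ∀ k → (∀ i → i < k → βs i ≢ y) → Chain v k αs βs
    mkChain k go = record
      { α₀ = refl
      ; α∈ = λ j≤k → proj₁ (αi j≤k)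
      ; β∈ = λ j≤k → proj₁ (βi j≤k)
      ; β→α = λ j≤k → proj₂ (βi j≤k)
      ; α→β = λ {j} j<k → let β∈ , β→α = βi (ℕₚ.<⇒≤ j<k) in
          proj₂ (αs-spec j β∈ (λ β∈v → indep v β∈v (proj₁ (αi (ℕₚ.<⇒≤ j<k))) β→α) (go j j<k)) }
      where
      αi : ∀ {j} → j ≤ k → αs j ∈ S v × αs j ∉ S w
      αi j≤k = α-inv _ (λ i i<j → go i (≤-trans i<j j≤k))
      βi : ∀ {j} → j ≤ k → βs j ∈ S w × βs j ⟶ αs j
      βi {j} j≤k = let α∈ , α∉ = αi j≤k in βs-spec j α∈ α∉

    build : (∀ i → i < suc n → βs i ≢ y) ⊎ ∃[ k ] (βs k ≡ y × ∀ i → i < k → βs i ≢ y) →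
            ∃[ k ] ∃[ α ] ∃[ β ] Path v k α β
    build (inj₁ never) = ⊥-elim (1+n≰n (injective⇒≤ {m = suc n} {f = αs ∘ toℕ}
      λ {i} {j} eq → toℕ-injective (Chain.α-injective (mkChain n (λ i i<n → never i (≤-trans i<n (n≤1+n n))))
        (s≤s⁻¹ (toℕ<n i)) (s≤s⁻¹ (toℕ<n j)) eq)))
    build (inj₂ (k , eq , before)) = k , αs , βs , record
      { chain = mkChain k before
      ; last = subst (v ⟶_) (sym eq) v→y }

-- An induced directed cycle v → P r → Q r → P (r - 1) → … → P 0 → Q 0 → v.
record OddHole {n} (D : Digraph n) : Set where
  field
    r       : ℕ
    v       : Fin n
    P Q     : ℕ → Fin n
    P→Q     : ∀ {i} → i ≤ r → Arc D (P i) (Q i)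
    Q→P     : ∀ {i} → i < r → Arc D (Q (suc i)) (P i)
    v→P     : Arc D v (P r)
    Q→v     : Arc D (Q 0) v
    P→Q⇒    : ∀ {i j} → i ≤ r → j ≤ r → Arc D (P i) (Q j) → i ≡ j
    Q→P⇒    : ∀ {i j} → i ≤ r → j ≤ r → Arc D (Q i) (P j) → i ≡ suc j
    v→P⇒    : ∀ {j} → j ≤ r → Arc D v (P j) → j ≡ r
    Q→v⇒    : ∀ {j} → j ≤ r → Arc D (Q j) v → j ≡ 0
    ¬P→P    : ∀ {i j} → i ≤ r → j ≤ r → ¬ Arc D (P i) (P j)
    ¬Q→Q    : ∀ {i j} → i ≤ r → j ≤ r → ¬ Arc D (Q i) (Q j)
    ¬v→Q    : ∀ {j} → j ≤ r → ¬ Arc D v (Q j)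
    ¬P→v    : ∀ {j} → j ≤ r → ¬ Arc D (P j) v

triangleHole : ∀ {n} (D : Digraph n) {a b c} → Arc D a b → Arc D b c → Arc D c a →
               ¬ Arc D b a → ¬ Arc D c b → ¬ Arc D a c → OddHole D
triangleHole D {a} {b} {c} a→b b→c c→a ¬b→a ¬c→b ¬a→c = record
  { r = 0 ; v = a ; P = λ _ → b ; Q = λ _ → c
  ; P→Q = λ _ → b→c ; Q→P = λ () ; v→P = a→b ; Q→v = c→a
  ; P→Q⇒ = λ { z≤n z≤n _ → refl } ; Q→P⇒ = λ _ _ c→b → ⊥-elim (¬c→b c→b)
  ; v→P⇒ = λ { z≤n _ → refl } ; Q→v⇒ = λ { z≤n _ → refl }
  ; ¬P→P = λ _ _ b→b → loop-free D b→b refl ; ¬Q→Q = λ _ _ c→c → loop-free D c→c refl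
  ; ¬v→Q = λ _ → ¬a→c ; ¬P→v = λ _ → ¬b→a }

-- Comparing the cycles of `v` and `f v`

module Shifts {n} (D : Digraph n) (insemi : LocallyInSemicomplete D) (sys : KernelSystem D) where
  open InSystem D insemi sys

  chordless : ∀ v → ¬ f (f v) ⟶ v → OddHole D
  chordless v ¬chord = let k , α , β , p = path v in hole k α β p
    where
    hole : ∀ k α β → Path v k α β → OddHole D
    hole k α β p = record
      { r = k ; v = v ; P = β ; Q = α
      ; P→Q = β→α ; Q→P = α→β ; v→P = last ; Q→v = subst (_⟶ v) (sym α₀) (f→ v)
      ; P→Q⇒ = λ i≤k j≤k e → sym (α-injective j≤k i≤k (out-β i≤k (α∈ j≤k) e))
      ; Q→P⇒ = λ i≤k j≤k e → Q→P⇒ i≤k j≤k (out-α i≤k (β∈ j≤k) e)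
      ; v→P⇒ = λ j≤k e → β-injective j≤k ≤-refl (v→⇒β (β∈ j≤k) e)
      ; Q→v⇒ = α-v
      ; ¬P→P = λ i≤k j≤k → indep (f v) (β∈ i≤k) (β∈ j≤k)
      ; ¬Q→Q = λ i≤k j≤k → indep v (α∈ i≤k) (α∈ j≤k)
      ; ¬v→Q = v-α
      ; ¬P→v = λ j≤k e → ¬chord (subst (_⟶ v) (trans (→v⇒β (β∈ j≤k) e) β₀) e) }
      where
      open Path p
      Q→P⇒ : ∀ {i j} → i ≤ k → j ≤ k → ∃[ i′ ] (i ≡ suc i′ × β j ≡ β i′) → i ≡ suc j
      Q→P⇒ i≤k j≤k (i′ , refl , eq) = cong suc (sym (β-injective j≤k (ℕₚ.<⇒≤ i≤k) eq))

  module _ {v k α β k′ α′ β′} (p : Path v k α β) (q : Path (f v) k′ α′ β′) where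
    open Path p
    private module Q = Path q

    -- Both `α (j + 1)` and `β′ j` point to `β j = α′ j`, so they are equal or adjacent. In each
    -- case a further pair of in-neighbours either identifies `β (j + 1)` with `α′ (j + 1)` or
    -- contradicts injectivity.
    agree : ∀ j → j ≤ k → j ≤ k′ × α′ j ≡ β j
    agree zero    _   = z≤n , trans Q.α₀ (sym β₀)
    agree (suc j) j<k with agree j (ℕₚ.<⇒≤ j<k)
    ... | j≤k′ , eq = align (β′ j ≟ α (suc j))
      where
      j≤k = ℕₚ.<⇒≤ j<k
      Goal = suc j ≤ k′ × α′ (suc j) ≡ β (suc j)

      fork : β′ j ⟶ β j
      fork = subst (β′ j ⟶_) eq (Q.β→α j≤k′)

      viaβ′ : β (suc j) ⟶ β′ j → Goal
      viaβ′ e = let j<k′ , eq′ = Q.in-β j≤k′ (β∈ j<k) e in j<k′ , sym eq′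

      αβ′ : α (suc j) ⟶ β′ j → j < k′ ⊎ j ≡ k′ → Goal
      -- For `j = k′` the vertex `α 0 = f v` points to `β′ j` as well, against uniqueness of
      -- in-neighbours in `S v`.
      αβ′ e (inj₂ refl) with () ← α-injective j<k z≤n
        (uniqueIn v (α∈ j<k) (α∈ z≤n) e (subst (_⟶ β′ j) (sym α₀) Q.last))
      αβ′ e (inj₁ j<k′) with insemi (β′ j) (α′ (suc j)) (α (suc j)) (Q.α→β j<k′) e
                               (apart (f v) (Q.α∈ j<k′) (α∉ j<k))
      ... | inj₁ α′→α = j<k′ , in-α j<k (Q.α∈ j<k′) α′→α
      ... | inj₂ α→α′ with i , refl , eq′ ← out-α j<k (Q.α∈ j<k′) α→α′ =
        ⊥-elim (ℕₚ.1+n≢n (Q.α-injective j<k′ j≤k′ (trans eq′ (sym eq))))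

      align : Dec (β′ j ≡ α (suc j)) → Goal
      align (yes eq′) = viaβ′ (subst (β (suc j) ⟶_) (sym eq′) (β→α j<k))
      align (no ≢) with insemi (β j) (α (suc j)) (β′ j) (α→β j<k) fork (≢ ∘ sym)
      ... | inj₁ α→β′ = αβ′ α→β′ (m≤n⇒m<n∨m≡n j≤k′)
      ... | inj₂ β′→α with insemi (α (suc j)) (β′ j) (β (suc j)) β′→α (β→α j<k)
                             (apart (f v) (β∈ j<k) (Q.β∉ j≤k′) ∘ sym)
      ...   | inj₂ β→β′ = viaβ′ β→β′
      ...   | inj₁ β′→β = ⊥-elim (ℕₚ.1+n≢n (β-injective j<k j≤k
                            (trans (Q.out-β j≤k′ (β∈ j<k) β′→β) eq)))

    module _ (chords : ∀ u → f (f u) ⟶ u) (1≤k : 1 ≤ k) where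
      k≤k′ : k ≤ k′
      k≤k′ = proj₁ (agree k ≤-refl)

      αβ : ∀ {j} → j ≤ k → α′ j ≡ β j
      αβ j≤k = proj₂ (agree _ j≤k)

      v∉₂ : v ∉ S (f (f v))
      v∉₂ v∈ = unabs (f (f v)) v∈ (chords v)

      distinct₀ : α′ 0 ≢ α′ k
      distinct₀ eq = ℕₚ.<⇒≢ 1≤k (Q.α-injective z≤n k≤k′ eq)

      -- `v` and `β′ k` both point to `β k = α′ k`. If `β′ k → v`, comparison with the chord at `v`
      -- gives `β′ k → f (f v) = α′ 0`; but the out-neighbour of `β′ k` in `S (f v)` is `α′ k`,
      -- which differs from `α′ 0` as `k ≥ 1`.
      top : v ⟶ β′ k
      top with insemi (β k) v (β′ k) last (subst (β′ k ⟶_) (αβ ≤-refl) (Q.β→α k≤k′))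
                 (apart (f (f v)) (Q.β∈ k≤k′) v∉₂ ∘ sym)
      ... | inj₁ v→β′ = v→β′
      ... | inj₂ β′→v with insemi v (f (f v)) (β′ k) (chords v) β′→v
                             (apart (f (f v)) (Q.β∈ k≤k′) (self∉ (f (f v))) ∘ sym)
      ...   | inj₁ x→β′ = ⊥-elim (unabs (f (f v)) (Q.β∈ k≤k′) x→β′)
      ...   | inj₂ β′→x = ⊥-elim (distinct₀
                (trans Q.α₀ (Q.out-β k≤k′ (f∈ (f v)) β′→x)))

      -- In a longer second path `α′ (k + 1)` and `v` would both point to `β′ k` and so be adjacent;
      -- but within `S (f v)` only `β 0 = α′ 0` and `β k = α′ k` can be adjacent to `v`.
      k′≡k : k′ ≡ k
      k′≡k with m≤n⇒m<n∨m≡n k≤k′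
      ... | inj₂ k≡k′ = sym k≡k′
      ... | inj₁ k<k′ with insemi (β′ k) (α′ (suc k)) v (Q.α→β k<k′) top
                             (apart (f v) (Q.α∈ k<k′) (Pair.v∉ v))
      ...   | inj₁ α′→v with () ← Q.α-injective k<k′ z≤n
                (trans (→v⇒β (Q.α∈ k<k′) α′→v) (sym (αβ z≤n)))
      ...   | inj₂ v→α′ = ⊥-elim (ℕₚ.1+n≢n (Q.α-injective k<k′ k≤k′
                (trans (v→⇒β (Q.α∈ k<k′) v→α′) (sym (αβ ≤-refl)))))

  -- Re-indexes the next cycle so that its first family is literally `β`; iteration then gives
  -- consecutive cycles that share a family.
  shift : (∀ u → f (f u) ⟶ u) → ∀ {v k α β} → 1 ≤ k → Path v k α β →
          ∃[ γ ] (Path (f v) k β γ × v ⟶ γ k)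
  shift chords {v} {k} {α} {β} 1≤k p with path (f v)
  ... | k′ , α′ , β′ , q with k′≡k p q chords 1≤k
  ...   | refl = β′ , record
          { chain = record
            { α₀ = β₀ ; α∈ = β∈ ; β∈ = R.β∈
            ; β→α = λ j≤k → subst (_ ⟶_) (same j≤k) (R.β→α j≤k)
            ; α→β = λ j<k → subst (_⟶ _) (same j<k) (R.α→β j<k) }
          ; last = R.last } , top p q chords 1≤k
    where
    open Path p
    module R = Path q
    same : ∀ {j} → j ≤ k → α′ j ≡ β j
    same = αβ p q chords 1≤k

-- Odd holes from consecutive cycles with `k ≥ 1`

module Long {n} (D : Digraph n) (insemi : LocallyInSemicomplete D) (sys : KernelSystem D)
            (chords : ∀ u → Arc D (KernelSystem.f sys (KernelSystem.f sys u)) u) where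
  open InSystem D insemi sys
  open Shifts D insemi sys

  module Consecutive {v k₀ α β γ} (p : Path v (suc k₀) α β) (q : Path (f v) (suc k₀) β γ) where
    k = suc k₀
    w = f v
    x = f w
    open Path p public
    module Q = Path q

    γ₀ : γ 0 ≡ f x
    γ₀ = Q.β₀

    -- If `α (j + 1)` is outside `S x`, some `s` in `S x` absorbs it, and an in-neighbour of `s` in
    -- `S w` must be `β (j + 1)` or `β j`. The former leads to `s = γ j`; the latter to
    -- `s = γ (j − 1)`, which by induction equals `α j` or already has `α j` as its in-neighbour in
    -- `S v`.
    descend : ∀ j → suc j ≤ k → α (suc j) ⟶ γ j ⊎ α (suc j) ≡ γ j
    descend₁ : ∀ j → suc j ≤ k → (∀ i → suc i ≡ j → α (suc i) ⟶ γ i ⊎ α (suc i) ≡ γ i) →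
               α (suc j) ⟶ γ j ⊎ α (suc j) ≡ γ j

    descend zero    j<k = descend₁ zero j<k λ _ ()
    descend (suc j) j<k = descend₁ (suc j) j<k λ { i refl → descend i (ℕₚ.<⇒≤ j<k) }

    descend₁ j j<k below with T? (S x (α (suc j)))
    ... | yes α∈x with i , refl , eq ← Q.out-α j<k α∈x (β→α j<k) = inj₂ eq
    ... | no α∉x with absorb x (apart w (f∈ w) (α∉ j<k) ∘ sym) α∉x
    ...   | s , s∈ , α→s with T? (S w s)
    ...     | yes s∈w with i , refl , refl ← out-α j<k s∈w α→s = ⊥-elim (Q.α∉ (ℕₚ.<⇒≤ j<k) s∈)
    ...     | no s∉w with Pair.predB w s∈ s∉w
    ...       | inj₁ refl with () ← α-injective j<k z≤n
                  (uniqueIn v (α∈ j<k) (α∈ z≤n) α→s (subst (_⟶ s) (sym α₀) (Pair.v→y w)))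
    ...       | inj₂ (a , a∈ , a→s) with insemi s a (α (suc j)) a→s α→s (apart w a∈ (α∉ j<k))
    ...         | inj₁ a→α with refl ← in-α j<k a∈ a→α
                           with i , refl , refl ← Q.out-α j<k s∈ a→s = inj₁ α→s
    ...         | inj₂ α→a with j , refl , refl ← out-α j<k a∈ α→a
                           with i , refl , refl ← Q.out-α (ℕₚ.<⇒≤ j<k) s∈ a→s
                           with below i refl
    ...           | inj₁ α→γ = ⊥-elim (ℕₚ.1+n≢n (α-injective j<k (ℕₚ.<⇒≤ j<k)
                                  (uniqueIn v (α∈ j<k) (α∈ (ℕₚ.<⇒≤ j<k)) α→s α→γ)))
    ...           | inj₂ α≡γ = ⊥-elim (indep v (α∈ j<k) (α∈ (ℕₚ.<⇒≤ j<k))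
                                  (subst (α (suc j) ⟶_) (sym α≡γ) α→s))

    -- By `descend`, `α k` equals `γ k₀` or points to it, and `v` and `α k` are not adjacent because
    -- `k ≥ 1`.
    ¬v→γ : ¬ v ⟶ γ k₀
    ¬v→γ v→γ with descend k₀ ≤-refl
    ... | inj₂ α≡γ = v-α ≤-refl (subst (v ⟶_) (sym α≡γ) v→γ)
    ... | inj₁ α→γ with insemi (γ k₀) v (α k) v→γ α→γ (apart v (α∈ ≤-refl) (self∉ v) ∘ sym)
    ...   | inj₁ v→α = v-α ≤-refl v→α
    ...   | inj₂ α→v with () ← α-v ≤-refl α→v

    v∉x : v ∉ S x
    v∉x v∈ = unabs x v∈ (chords v)

    -- An in-neighbour of `s` in `S w` is adjacent to `v`, hence is `β 0 = x`, which has no arc into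
    -- `S x`, or `β k`, whose only out-neighbour in `S x` is `γ k₀`, excluded by `¬v→γ`.
    v→⇒γ : ∀ {s} → s ∈ S x → v ⟶ s → s ≡ γ k
    v→⇒γ {s} s∈ v→s with T? (S w s)
    ... | yes s∈w with refl ← v→⇒β s∈w v→s = ⊥-elim (Q.α∉ ≤-refl s∈)
    ... | no s∉w with Pair.predB w s∈ s∉w
    ...   | inj₁ refl = Q.v→⇒β s∈ (Pair.v→y w)
    ...   | inj₂ (a , a∈ , a→s) with insemi s a v a→s v→s (apart w a∈ (Pair.v∉ v))
    ...     | inj₁ a→v = ⊥-elim (unabs x s∈ (subst (_⟶ s) (trans (→v⇒β a∈ a→v) β₀) a→s))
    ...     | inj₂ v→a with refl ← v→⇒β a∈ v→a
                       with i , refl , refl ← Q.out-α ≤-refl s∈ a→s = ⊥-elim (¬v→γ v→s)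

    →v⇒γ : ∀ {s} → s ∈ S x → s ⟶ v → s ≡ γ 0
    →v⇒γ {s} s∈ s→v with insemi v s x s→v (chords v) (apart x s∈ (self∉ x))
    ... | inj₁ s→x = trans (into-v x s∈ s→x) (sym γ₀)
    ... | inj₂ x→s = ⊥-elim (unabs x s∈ x→s)

    ¬v→γ₀ : ¬ v ⟶ γ 0
    ¬v→γ₀ v→γ with () ← Q.β-injective z≤n ≤-refl (v→⇒γ (Q.β∈ z≤n) v→γ)

    -- The cycle `v → β k → γ k₀ → β k₀ → … → β 1 → γ 0 → v`, of length `2k + 1`.
    chordHole : γ 0 ⟶ v → OddHole D
    chordHole γ→v = record
      { r = k₀ ; v = v ; P = β ∘ suc ; Q = γ
      ; P→Q = λ i≤ → Q.α→β (s≤s i≤)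
      ; Q→P = λ i< → Q.β→α (≤-trans i< (n≤1+n _))
      ; v→P = last ; Q→v = γ→v
      ; P→Q⇒ = λ i≤ j≤ e → P→Q⇒ i≤ j≤ (Q.out-α (s≤s i≤) (Q.β∈ (up j≤)) e)
      ; Q→P⇒ = λ i≤ j≤ e → Q.α-injective (up i≤) (s≤s j≤) (sym (Q.out-β (up i≤) (β∈ (s≤s j≤)) e))
      ; v→P⇒ = λ j≤ e → ℕₚ.suc-injective (β-injective (s≤s j≤) ≤-refl (v→⇒β (β∈ (s≤s j≤)) e))
      ; Q→v⇒ = λ j≤ e → Q.β-injective (up j≤) z≤n (→v⇒γ (Q.β∈ (up j≤)) e)
      ; ¬P→P = λ i≤ j≤ → indep w (β∈ (s≤s i≤)) (β∈ (s≤s j≤))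
      ; ¬Q→Q = λ i≤ j≤ → indep x (Q.β∈ (up i≤)) (Q.β∈ (up j≤))
      ; ¬v→Q = λ j≤ e → ℕₚ.<⇒≢ (s≤s j≤) (Q.β-injective (up j≤) ≤-refl (v→⇒γ (Q.β∈ (up j≤)) e))
      ; ¬P→v = λ j≤ e → ℕₚ.1+n≢0 (β-injective (s≤s j≤) z≤n (→v⇒β (β∈ (s≤s j≤)) e)) }
      where
      up : ∀ {j} → j ≤ k₀ → j ≤ k
      up j≤ = ≤-trans j≤ (n≤1+n k₀)
      P→Q⇒ : ∀ {i j} → i ≤ k₀ → j ≤ k₀ → ∃[ i′ ] (suc i ≡ suc i′ × γ j ≡ γ i′) → i ≡ j
      P→Q⇒ i≤ j≤ (_ , refl , eq) = sym (Q.β-injective (up j≤) (up i≤) eq)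

  -- For `k ≥ 2` a hole of length `2k + 1` is routed through a single vertex `s = ε 0` of a third
  -- kernel. Whether `β 2 → s` is an arc decides between two routes.
  module LongPaths {v k₁ α β γ ε} (p : Path v (suc (suc k₁)) α β) (q : Path (f v) (suc (suc k₁)) β γ)
               (r : Path (f (f v)) (suc (suc k₁)) γ ε)
               (¬γ→v : ¬ γ 0 ⟶ v) (¬ε→w : ¬ ε 0 ⟶ f v) where
    module V = Consecutive p q
    module W = Consecutive q r
    open V using (k; w; x; β∈; last; β-injective; β₀; v→⇒β; →v⇒β; v→⇒γ; →v⇒γ)
    module R = Path r

    1≤k : 1 ≤ k
    1≤k = s≤s z≤n

    s : Fin n
    s = ε 0

    s→β₀ : s ⟶ β 0
    s→β₀ = subst₂ _⟶_ (sym R.β₀) (sym β₀) (chords x)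

    s→γ⇒ : ∀ {j} → j ≤ k → s ⟶ γ j → j ≡ 0
    s→γ⇒ j≤ e = R.α-injective j≤ z≤n (R.out-β z≤n (R.α∈ j≤) e)

    γ→s⇒ : ∀ {j} → j ≤ k → γ j ⟶ s → j ≡ 1
    γ→s⇒ j≤ e = R.α-injective j≤ 1≤k (proj₂ (R.in-β z≤n (R.α∈ j≤) e))

    γ₁→s : γ 1 ⟶ s
    γ₁→s = R.α→β (s≤s z≤n)

    s→β⇒ : ∀ {j} → j ≤ k → s ⟶ β j → j ≤ 1
    s→β⇒ {j} j≤ e with insemi (β j) s (γ j) e (W.β→α j≤) (apart x (R.α∈ j≤) (R.β∉ z≤n) ∘ sym)
    ... | inj₁ s→γ = subst (_≤ 1) (sym (s→γ⇒ j≤ s→γ)) z≤n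
    ... | inj₂ γ→s = ℕₚ.≤-reflexive (γ→s⇒ j≤ γ→s)

    -- `β j` would be adjacent to `γ 1`, the in-neighbour of `s` among the `γ`. Among the `β`, only
    -- `β 1` and `β 2` are adjacent to `γ 1`, whence the bound 3 on `j`.
    ¬β→s : ∀ {j} → j ≤ k → 3 ≤ j → ¬ β j ⟶ s
    ¬β→s {j} j≤ 3≤j e with insemi s (β j) (γ 1) e γ₁→s (apart w (β∈ j≤) (W.β∉ 1≤k))
    ... | inj₂ γ→β with refl ← β-injective j≤ 1≤k (W.out-β 1≤k (β∈ j≤) γ→β) with s≤s () ← 3≤j
    ... | inj₁ β→γ with i , refl , eq ← W.out-α j≤ (W.β∈ 1≤k) β→γ
                   with refl ← W.β-injective 1≤k (ℕₚ.<⇒≤ j≤) eq with s≤s (s≤s ()) ← 3≤j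

    ¬w→s : ¬ w ⟶ s
    ¬w→s = W.¬v→γ₀

    s≢w : s ≢ w
    s≢w s≡w = asym w (subst₂ _⟶_ s≡w β₀ s→β₀)

    ¬s→v : ¬ s ⟶ v
    ¬s→v e with insemi v s w e (f→ v) s≢w
    ... | inj₁ s→w = ¬ε→w s→w
    ... | inj₂ w→s = ¬w→s w→s

    ¬v→s : ¬ v ⟶ s
    ¬v→s e with insemi s v (γ 1) e γ₁→s (apart x (W.β∈ 1≤k) V.v∉x ∘ sym)
    ... | inj₁ v→γ with () ← W.β-injective 1≤k ≤-refl (v→⇒γ (W.β∈ 1≤k) v→γ)
    ... | inj₂ γ→v with () ← W.β-injective 1≤k z≤n (→v⇒γ (W.β∈ 1≤k) γ→v)

    ¬β₀→γ : ∀ {j} → j ≤ k → ¬ β 0 ⟶ γ j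
    ¬β₀→γ {j} j≤ e = unabs x (W.β∈ j≤) (subst (_⟶ γ j) β₀ e)

    ¬β₀→s : ¬ β 0 ⟶ s
    ¬β₀→s e with insemi s (β 0) (γ 1) e γ₁→s (apart w (β∈ z≤n) (W.β∉ 1≤k))
    ... | inj₁ β→γ = ¬β₀→γ 1≤k β→γ
    ... | inj₂ γ→β with () ← β-injective z≤n 1≤k (W.out-β 1≤k (β∈ z≤n) γ→β)

    w→⇒γ : ∀ {j} → j ≤ k → w ⟶ γ j → j ≡ k
    w→⇒γ j≤ e = W.β-injective j≤ ≤-refl (W.v→⇒β (W.β∈ j≤) e)

    ¬w→β : ∀ {j} → j ≤ k → ¬ w ⟶ β j
    ¬w→β j≤ = unabs w (β∈ j≤)

    β→w⇒ : ∀ {j} → j ≤ k → β j ⟶ w → j ≡ 0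
    β→w⇒ j≤ e = W.α-v j≤ e

    γ→w⇒ : ∀ {j} → j ≤ k → γ j ⟶ w → j ≡ 0
    γ→w⇒ j≤ e = W.β-injective j≤ z≤n (W.→v⇒β (W.β∈ j≤) e)

    γ→β⇒ : ∀ {i j} → i ≤ k → j ≤ k → γ i ⟶ β j → j ≡ i
    γ→β⇒ i≤ j≤ e = β-injective j≤ i≤ (W.out-β i≤ (β∈ j≤) e)

    β→γ⇒ : ∀ {i j} → suc i ≤ k → j ≤ k → β (suc i) ⟶ γ j → i ≡ j
    β→γ⇒ i< j≤ e with _ , refl , eq ← W.out-α i< (W.β∈ j≤) e = W.β-injective (ℕₚ.<⇒≤ i<) j≤ (sym eq)

    v→β⇒ : ∀ {j} → j ≤ k → v ⟶ β j → j ≡ k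
    v→β⇒ j≤ e = β-injective j≤ ≤-refl (v→⇒β (β∈ j≤) e)

    ¬v→β₀ : ¬ v ⟶ β 0
    ¬v→β₀ e with () ← v→β⇒ z≤n e

    β→v⇒ : ∀ {j} → j ≤ k → β j ⟶ v → j ≡ 0
    β→v⇒ j≤ e = β-injective j≤ z≤n (→v⇒β (β∈ j≤) e)

    β₀→v : β 0 ⟶ v
    β₀→v = subst (_⟶ v) (sym β₀) (chords v)

    β₀→w : β 0 ⟶ w
    β₀→w = subst (_⟶ w) (sym β₀) (f→ w)

    up : ∀ {j} → j ≤ suc k₁ → j ≤ k
    up j≤ = ≤-trans j≤ (n≤1+n _)

    -- The cycle `v → β k → γ (k − 1) → β (k − 1) → … → β 2 → γ 1 → s → β 0 → v`.
    hole₃ : ¬ β 2 ⟶ s → OddHole D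
    hole₃ ¬β₂→s = record
      { r = suc k₁ ; v = v ; P = P ; Q = Q
      ; P→Q = P→Q ; Q→P = Q→P ; v→P = last ; Q→v = β₀→v
      ; P→Q⇒ = P→Q⇒ ; Q→P⇒ = Q→P⇒ ; v→P⇒ = v→P⇒ ; Q→v⇒ = Q→v⇒
      ; ¬P→P = ¬P→P ; ¬Q→Q = ¬Q→Q ; ¬v→Q = ¬v→Q ; ¬P→v = ¬P→v }
      where
      P Q : ℕ → Fin n
      P zero    = s
      P (suc j) = β (suc (suc j))
      Q zero    = β 0
      Q (suc j) = γ (suc j)

      ¬β⁺→s : ∀ {j} → suc (suc j) ≤ k → ¬ β (suc (suc j)) ⟶ s
      ¬β⁺→s {zero}  _  = ¬β₂→s
      ¬β⁺→s {suc j} j≤ = ¬β→s j≤ (s≤s (s≤s (s≤s z≤n)))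

      P→Q : ∀ {i} → i ≤ suc k₁ → P i ⟶ Q i
      P→Q {zero}  _  = s→β₀
      P→Q {suc i} i≤ = W.α→β (s≤s i≤)

      Q→P : ∀ {i} → i < suc k₁ → Q (suc i) ⟶ P i
      Q→P {zero}  _  = γ₁→s
      Q→P {suc i} i< = W.β→α (up i<)

      P→Q⇒ : ∀ {i j} → i ≤ suc k₁ → j ≤ suc k₁ → P i ⟶ Q j → i ≡ j
      P→Q⇒ {zero}  {zero}  _ _ _ = refl
      P→Q⇒ {zero}  {suc j} _ j≤ e = sym (s→γ⇒ (up j≤) e)
      P→Q⇒ {suc i} {zero}  i≤ _ e = ⊥-elim (indep w (β∈ (s≤s i≤)) (β∈ z≤n) e)
      P→Q⇒ {suc i} {suc j} i≤ j≤ e = β→γ⇒ (s≤s i≤) (up j≤) e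

      Q→P⇒ : ∀ {i j} → i ≤ suc k₁ → j ≤ suc k₁ → Q i ⟶ P j → i ≡ suc j
      Q→P⇒ {zero}  {zero}  _ _ e = ⊥-elim (¬β₀→s e)
      Q→P⇒ {zero}  {suc j} _ j≤ e = ⊥-elim (indep w (β∈ z≤n) (β∈ (s≤s j≤)) e)
      Q→P⇒ {suc i} {zero}  i≤ _ e = γ→s⇒ (up i≤) e
      Q→P⇒ {suc i} {suc j} i≤ j≤ e = sym (γ→β⇒ (up i≤) (s≤s j≤) e)

      v→P⇒ : ∀ {j} → j ≤ suc k₁ → v ⟶ P j → j ≡ suc k₁
      v→P⇒ {zero}  _ e = ⊥-elim (¬v→s e)
      v→P⇒ {suc j} j≤ e = ℕₚ.suc-injective (v→β⇒ (s≤s j≤) e)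

      Q→v⇒ : ∀ {j} → j ≤ suc k₁ → Q j ⟶ v → j ≡ 0
      Q→v⇒ {zero}  _ _ = refl
      Q→v⇒ {suc j} j≤ e = W.β-injective (up j≤) z≤n (→v⇒γ (W.β∈ (up j≤)) e)

      ¬P→P : ∀ {i j} → i ≤ suc k₁ → j ≤ suc k₁ → ¬ P i ⟶ P j
      ¬P→P {zero}  {zero}  _ _ e = loop-free D e refl
      ¬P→P {zero}  {suc j} _ j≤ e with s≤s () ← s→β⇒ (s≤s j≤) e
      ¬P→P {suc i} {zero}  i≤ _ e = ¬β⁺→s (s≤s i≤) e
      ¬P→P {suc i} {suc j} i≤ j≤ e = indep w (β∈ (s≤s i≤)) (β∈ (s≤s j≤)) e

      ¬Q→Q : ∀ {i j} → i ≤ suc k₁ → j ≤ suc k₁ → ¬ Q i ⟶ Q j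
      ¬Q→Q {zero}  {zero}  _ _ e = loop-free D e refl
      ¬Q→Q {zero}  {suc j} _ j≤ e = ¬β₀→γ (up j≤) e
      ¬Q→Q {suc i} {zero}  i≤ _ e with () ← γ→β⇒ (up i≤) z≤n e
      ¬Q→Q {suc i} {suc j} i≤ j≤ e = indep x (W.β∈ (up i≤)) (W.β∈ (up j≤)) e

      ¬v→Q : ∀ {j} → j ≤ suc k₁ → ¬ v ⟶ Q j
      ¬v→Q {zero}  _ e = ¬v→β₀ e
      ¬v→Q {suc j} j≤ e = ℕₚ.<⇒≢ (s≤s j≤) (W.β-injective (up j≤) ≤-refl (v→⇒γ (W.β∈ (up j≤)) e))

      ¬P→v : ∀ {j} → j ≤ suc k₁ → ¬ P j ⟶ v
      ¬P→v {zero}  _ e = ¬s→v e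
      ¬P→v {suc j} j≤ e with () ← β→v⇒ (s≤s j≤) e

    -- The cycle `w → γ k → β k → γ (k − 1) → … → γ 2 → β 2 → s → β 0 → w`.
    hole₄ : β 2 ⟶ s → OddHole D
    hole₄ β₂→s = record
      { r = suc k₁ ; v = w ; P = P ; Q = Q
      ; P→Q = P→Q ; Q→P = Q→P ; v→P = W.last ; Q→v = β₀→w
      ; P→Q⇒ = P→Q⇒ ; Q→P⇒ = Q→P⇒ ; v→P⇒ = v→P⇒ ; Q→v⇒ = Q→v⇒
      ; ¬P→P = ¬P→P ; ¬Q→Q = ¬Q→Q ; ¬v→Q = ¬v→Q ; ¬P→v = ¬P→v }
      where
      P Q : ℕ → Fin n
      P zero    = s
      P (suc j) = γ (suc (suc j))
      Q zero    = β 0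
      Q (suc j) = β (suc (suc j))

      P→Q : ∀ {i} → i ≤ suc k₁ → P i ⟶ Q i
      P→Q {zero}  _  = s→β₀
      P→Q {suc i} i≤ = W.β→α (s≤s i≤)

      Q→P : ∀ {i} → i < suc k₁ → Q (suc i) ⟶ P i
      Q→P {zero}  _  = β₂→s
      Q→P {suc i} i< = W.α→β (s≤s i<)

      P→Q⇒ : ∀ {i j} → i ≤ suc k₁ → j ≤ suc k₁ → P i ⟶ Q j → i ≡ j
      P→Q⇒ {zero}  {zero}  _ _ _ = refl
      P→Q⇒ {zero}  {suc j} _ j≤ e with s≤s () ← s→β⇒ (s≤s j≤) e
      P→Q⇒ {suc i} {zero}  i≤ _ e with () ← γ→β⇒ (s≤s i≤) z≤n e
      P→Q⇒ {suc i} {suc j} i≤ j≤ e = ℕₚ.suc-injective (sym (γ→β⇒ (s≤s i≤) (s≤s j≤) e))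

      Q→P⇒ : ∀ {i j} → i ≤ suc k₁ → j ≤ suc k₁ → Q i ⟶ P j → i ≡ suc j
      Q→P⇒ {zero}  {zero}  _ _ e = ⊥-elim (¬β₀→s e)
      Q→P⇒ {zero}  {suc j} _ j≤ e = ⊥-elim (¬β₀→γ (s≤s j≤) e)
      Q→P⇒ {suc zero}    {zero}  _ _ _ = refl
      Q→P⇒ {suc (suc i)} {zero}  i≤ _ e = ⊥-elim (¬β→s (s≤s i≤) (s≤s (s≤s (s≤s z≤n))) e)
      Q→P⇒ {suc i} {suc j} i≤ j≤ e = β→γ⇒ (s≤s i≤) (s≤s j≤) e

      v→P⇒ : ∀ {j} → j ≤ suc k₁ → w ⟶ P j → j ≡ suc k₁
      v→P⇒ {zero}  _ e = ⊥-elim (¬w→s e)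
      v→P⇒ {suc j} j≤ e = ℕₚ.suc-injective (w→⇒γ (s≤s j≤) e)

      Q→v⇒ : ∀ {j} → j ≤ suc k₁ → Q j ⟶ w → j ≡ 0
      Q→v⇒ {zero}  _ _ = refl
      Q→v⇒ {suc j} j≤ e with () ← β→w⇒ (s≤s j≤) e

      ¬P→P : ∀ {i j} → i ≤ suc k₁ → j ≤ suc k₁ → ¬ P i ⟶ P j
      ¬P→P {zero}  {zero}  _ _ e = loop-free D e refl
      ¬P→P {zero}  {suc j} _ j≤ e with () ← s→γ⇒ (s≤s j≤) e
      ¬P→P {suc i} {zero}  i≤ _ e with () ← γ→s⇒ (s≤s i≤) e
      ¬P→P {suc i} {suc j} i≤ j≤ e = indep x (W.β∈ (s≤s i≤)) (W.β∈ (s≤s j≤)) e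

      ¬Q→Q : ∀ {i j} → i ≤ suc k₁ → j ≤ suc k₁ → ¬ Q i ⟶ Q j
      ¬Q→Q {zero}  {zero}  _ _ e = loop-free D e refl
      ¬Q→Q {zero}  {suc j} _ j≤ e = indep w (β∈ z≤n) (β∈ (s≤s j≤)) e
      ¬Q→Q {suc i} {zero}  i≤ _ e = indep w (β∈ (s≤s i≤)) (β∈ z≤n) e
      ¬Q→Q {suc i} {suc j} i≤ j≤ e = indep w (β∈ (s≤s i≤)) (β∈ (s≤s j≤)) e

      ¬v→Q : ∀ {j} → j ≤ suc k₁ → ¬ w ⟶ Q j
      ¬v→Q {zero}  _ = ¬w→β z≤n
      ¬v→Q {suc j} j≤ = ¬w→β (s≤s j≤)

      ¬P→v : ∀ {j} → j ≤ suc k₁ → ¬ P j ⟶ w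
      ¬P→v {zero}  _ e = ¬ε→w e
      ¬P→v {suc j} j≤ e with () ← γ→w⇒ (s≤s j≤) e

    hole : OddHole D
    hole with T? (adj D (β 2) s)
    ... | yes β₂→s = hole₄ β₂→s
    ... | no ¬β₂→s = hole₃ ¬β₂→s

-- Embedded circulants

record Embedding {n} (D : Digraph n) (m : ℕ) (J : ℕ → Set) : Set where
  field
    h           : Fin m → Fin n
    h-injective : ∀ {i j} → h i ≡ h j → i ≡ j
    arcs        : ∀ i j → Arc D (h i) (h j) ⇔ CircArc m J i j

infixl 6 _⊕_
_⊕_ : Fin 7 → ℕ → Fin 7
i ⊕ d = fromℕ< (m%n<n (toℕ i + d) 7)

circ7? : ∀ i j → Dec (CircArc 7 J-1-2 i j)
circ7? i j = map′ to from (hit? 1 ⊎-dec hit? 2)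
  where
  Hit : ℕ → Set
  Hit d = toℕ i + d ≡ toℕ j ⊎ toℕ i + d ≡ toℕ j + 7
  hit? : ∀ d → Dec (Hit d)
  hit? d = (toℕ i + d ℕₚ.≟ toℕ j) ⊎-dec (toℕ i + d ℕₚ.≟ toℕ j + 7)
  to : Hit 1 ⊎ Hit 2 → CircArc 7 J-1-2 i j
  to (inj₁ e) = 1 , inj₁ refl , s≤s z≤n , s≤s (s≤s z≤n) , e
  to (inj₂ e) = 2 , inj₂ refl , s≤s z≤n , s≤s (s≤s (s≤s z≤n)) , e
  from : CircArc 7 J-1-2 i j → Hit 1 ⊎ Hit 2
  from (_ , inj₁ refl , _ , _ , e) = inj₁ e
  from (_ , inj₂ refl , _ , _ , e) = inj₂ e

circ₁ : ∀ i → CircArc 7 J-1-2 i (i ⊕ 1)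
circ₁ = from-yes (all? λ i → circ7? i (i ⊕ 1))
circ₂ : ∀ i → CircArc 7 J-1-2 i (i ⊕ 2)
circ₂ = from-yes (all? λ i → circ7? i (i ⊕ 2))

jump : ∀ i j → CircArc 7 J-1-2 i j → j ≡ i ⊕ 1 ⊎ j ≡ i ⊕ 2
jump = from-yes (all? λ i → all? λ j → circ7? i j →-dec
         ((j ≟ i ⊕ 1) ⊎-dec (j ≟ i ⊕ 2)))

record Web7 {n} (D : Digraph n) : Set where
  field
    h     : Fin 7 → Fin n
    arc₁  : ∀ i → Arc D (h i) (h (i ⊕ 1))
    arc₂  : ∀ i → Arc D (h i) (h (i ⊕ 2))
    ¬arc₃ : ∀ i → ¬ Arc D (h i) (h (i ⊕ 3))
    ¬arc₄ : ∀ i → ¬ Arc D (h i) (h (i ⊕ 4))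
    ¬arc₅ : ∀ i → ¬ Arc D (h i) (h (i ⊕ 5))
    ¬arc₆ : ∀ i → ¬ Arc D (h i) (h (i ⊕ 6))

web7⇒embedding : ∀ {n} (D : Digraph n) → Web7 D → Embedding D 7 J-1-2
web7⇒embedding D web = record
  { h = h
  ; h-injective = inj
  ; arcs = λ i j → mk⇔ (to i j) (from i j) }
  where
  open Web7 web

  difference : ∀ i j → ∃[ d ] j ≡ i ⊕ toℕ {7} d
  difference = from-yes (all? λ i → all? λ j → any? λ d → j ≟ i ⊕ toℕ {7} d)

  ⊕0 : ∀ i → i ⊕ 0 ≡ i
  ⊕0 = from-yes (all? λ i → i ⊕ 0 ≟ i)

  to : ∀ i j → Arc D (h i) (h j) → CircArc 7 J-1-2 i j
  to i j e with difference i j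
  ... | 0F , refl = ⊥-elim (loop-free D e (cong h (sym (⊕0 i))))
  ... | 1F , refl = circ₁ i
  ... | 2F , refl = circ₂ i
  ... | 3F , refl = ⊥-elim (¬arc₃ i e)
  ... | 4F , refl = ⊥-elim (¬arc₄ i e)
  ... | 5F , refl = ⊥-elim (¬arc₅ i e)
  ... | 6F , refl = ⊥-elim (¬arc₆ i e)

  from : ∀ i j → CircArc 7 J-1-2 i j → Arc D (h i) (h j)
  from i j c with jump i j c
  ... | inj₁ refl = arc₁ i
  ... | inj₂ refl = arc₂ i

  -- Distinct residues have distinct out-neighbourhoods in C₇(1,2), and `h` reflects arcs; this
  -- gives injectivity of `h`.
  separated : ∀ i j → (i ≡ j) ⊎ ∃[ t ] (CircArc 7 J-1-2 i t × ¬ CircArc 7 J-1-2 j t)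
  separated = from-yes (all? λ i → all? λ j → (i ≟ j) ⊎-dec
                any? λ t → circ7? i t ×-dec ¬? (circ7? j t))

  inj : ∀ {i j} → h i ≡ h j → i ≡ j
  inj {i} {j} eq with separated i j
  ... | inj₁ i≡j = i≡j
  ... | inj₂ (t , i→t , j↛t) = ⊥-elim (j↛t (to j t (subst (λ z → Arc D z (h t)) eq (from i t i→t))))

-- A missing arc `u → f (f u)`: an odd hole or C₇(1,2)

module Loose {n} (D : Digraph n) (insemi : LocallyInSemicomplete D) (sys : KernelSystem D)
              (chords : ∀ u → Arc D (KernelSystem.f sys (KernelSystem.f sys u)) u) where
  open InSystem D insemi sys
  open Shifts D insemi sys
  open Long D insemi sys chords

  module SevenVertices {v α β γ} (p : Path v 1 α β) (q : Path (f v) 1 β γ)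
               (¬γ→v : ¬ γ 0 ⟶ v) (v→γ : v ⟶ γ 1) (¬γ→α : ¬ γ 0 ⟶ α 1) where
    open Consecutive p q

    one : 1 ≤ 1
    one = ≤-refl

    α-apart : α 1 ≢ α 0
    α-apart eq with () ← α-injective one z≤n eq
    β-apart : β 1 ≢ β 0
    β-apart eq with () ← β-injective one z≤n eq
    γ-apart : γ 1 ≢ γ 0
    γ-apart eq with () ← Q.β-injective one z≤n eq

    γ₀→w : γ 0 ⟶ w
    γ₀→w = subst (_⟶ w) (sym γ₀) (chords w)

    α→γ : α 1 ⟶ γ 0
    α→γ with descend 0 one
    ... | inj₁ e  = e
    ... | inj₂ eq = ⊥-elim (indep v (α∈ one) (f∈ v) (subst (_⟶ w) (sym eq) γ₀→w))

    -- The vertex of `S v` that absorbs `γ 1` lies outside `S w`; its in-neighbour in `S w` is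
    -- adjacent to `γ 1`, so it is `β 1`, whose out-neighbour in `S v` is `α 1`.
    γ→α : γ 1 ⟶ α 1
    γ→α with T? (S v (γ 1))
    ... | yes γ∈v with s≤s () ← proj₁ (in-β one γ∈v (Q.β→α one))
    ... | no γ∉v with absorb v (apart x (Q.β∈ one) v∉x) γ∉v
    ...   | s , s∈ , γ→s with T? (S w s)
    ...     | yes s∈w with refl ← Q.out-β one s∈w γ→s = ⊥-elim (β∉ one s∈)
    ...     | no s∉w with Pair.predA v s∈ s∉w
    ...       | b , b∈ , b→s with insemi s b (γ 1) b→s γ→s (apart w b∈ (Q.β∉ one))
    ...         | inj₁ b→γ with s≤s () ← proj₁ (Q.in-β one b∈ b→γ)
    ...         | inj₂ γ→b with refl ← Q.out-β one b∈ γ→b = subst (γ 1 ⟶_) (out-β one s∈ b→s) γ→s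

    web : Web7 D
    web = record
      -- Each kernel occupies two positions at distance 3: `γ` has 0 and 3, `β` has 1 and 4, `α` has
      -- 2 and 5 with `α 0 = w`. Position 6 is `v`.
      { h = λ { 0F → γ 1 ; 1F → β 1 ; 2F → α 1 ; 3F → γ 0 ; 4F → β 0 ; 5F → w ; 6F → v }
      ; arc₁ = λ { 0F → Q.β→α one ; 1F → β→α one ; 2F → α→γ ; 3F → Q.β→α z≤n
                 ; 4F → subst (β 0 ⟶_) α₀ (β→α z≤n) ; 5F → f→ v ; 6F → v→γ }
      ; arc₂ = λ { 0F → γ→α ; 1F → Q.α→β one ; 2F → α→β one ; 3F → γ₀→w
                 ; 4F → subst (_⟶ v) (sym β₀) (chords v) ; 5F → Q.last ; 6F → last }
      ; ¬arc₃ = λ { 0F → indep x (Q.β∈ one) (Q.β∈ z≤n) ; 1F → indep w (β∈ one) (β∈ z≤n)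
                  ; 2F → indep v (α∈ one) (f∈ v) ; 3F → ¬γ→v
                  ; 4F → λ e → unabs x (Q.β∈ one) (subst (_⟶ γ 1) β₀ e)
                  ; 5F → unabs w (β∈ one) ; 6F → v-α one }
      ; ¬arc₄ = λ { 0F e → β-apart (sym (Q.out-β one (β∈ z≤n) e))
                  ; 1F e → α-apart (sym (trans α₀ (out-β one (f∈ v) e)))
                  ; 2F e → ⊥-elim (ℕₚ.1+n≢0 (α-v one e))
                  ; 3F → indep x (Q.β∈ z≤n) (Q.β∈ one) ; 4F → indep w (β∈ z≤n) (β∈ one)
                  ; 5F → indep v (f∈ v) (α∈ one)
                  ; 6F → ¬v→γ₀ }
      ; ¬arc₅ = λ { 0F e → γ-apart (Q.→v⇒β (Q.β∈ one) e) ; 1F e → β-apart (→v⇒β (β∈ one) e)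
                  ; 2F e → α-apart (trans (uniqueIn v (α∈ one) (f∈ v) e Q.last) (sym α₀))
                  ; 3F e → β-apart (Q.out-β z≤n (β∈ one) e)
                  ; 4F e → α-apart (out-β z≤n (α∈ one) e)
                  ; 5F e → γ-apart (sym (Q.v→⇒β (Q.β∈ z≤n) e))
                  ; 6F e → β-apart (sym (v→⇒β (β∈ z≤n) e)) }
      ; ¬arc₆ = λ { 0F e → γ-apart (→v⇒γ (Q.β∈ one) e)
                  ; 1F e → ¬β→γ (Q.out-α one (Q.β∈ one) e)
                  ; 2F e → ¬α→β (out-α one (β∈ one) e)
                  ; 3F → ¬γ→α
                  ; 4F e → unabs x (Q.β∈ z≤n) (subst (_⟶ γ 0) β₀ e)
                  ; 5F → unabs w (β∈ z≤n) ; 6F → asym v } }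
      where
      ¬β→γ : ¬ (∃[ i ] (1 ≡ suc i × γ 1 ≡ γ i))
      ¬β→γ (_ , refl , eq) = γ-apart eq
      ¬α→β : ¬ (∃[ i ] (1 ≡ suc i × β 1 ≡ β i))
      ¬α→β (_ , refl , eq) = β-apart eq

  -- The paths compared start at `v = f u`, so that `u` stays available: if `γ 0 → α 1`, then `u`,
  -- which also points to `α 1`, is adjacent to `γ 0`. The surviving case `u → γ 0` gives the
  -- induced triangle `u → γ 0 → w → u`, where `w = f (f u)`.
  long : ∀ u → ¬ u ⟶ f (f u) → OddHole D ⊎ Web7 D
  long u ¬u→ffu with path u
  -- For `k = 0` the closing arc is `u → β 0 = f (f u)`.
  ... | zero , _ , β , pu = ⊥-elim (¬u→ffu (subst (u ⟶_) (Path.β₀ pu) (Path.last pu)))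
  ... | suc k₀ , τ , α , pu = step₁ (shift chords (s≤s z≤n) pu)
    where
    v = f u
    k = suc k₀

    step₁ : ∃[ β ] (Path v k α β × u ⟶ β k) → OddHole D ⊎ Web7 D
    step₁ (β , pv , u→β) = step₂ (shift chords (s≤s z≤n) pv)
      where
      step₂ : ∃[ γ ] (Path (f v) k β γ × v ⟶ γ k) → OddHole D ⊎ Web7 D
      step₂ (γ , pw , v→γ) with T? (adj D (γ 0) v)
      ... | yes γ→v = inj₁ (Consecutive.chordHole pv pw γ→v)
      ... | no ¬γ→v = step₃ k₀ refl
        where
        w = f v
        module V = Consecutive pv pw

        step₃ : ∀ k₁ → k₀ ≡ k₁ → OddHole D ⊎ Web7 D
        step₃ zero refl with T? (adj D (γ 0) (α 1))
        ... | no ¬γ→α = inj₂ (SevenVertices.web pv pw ¬γ→v v→γ ¬γ→α)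
        ... | yes γ→α with insemi (α 1) (γ 0) u γ→α (Path.last pu) γ₀≢u
          where
          γ₀≢u : γ 0 ≢ u
          γ₀≢u eq with () ← V.β-injective (≤-refl {1}) z≤n
            (V.Q.out-β z≤n (V.β∈ ≤-refl) (subst (_⟶ β 1) (sym eq) u→β))
        ...   | inj₂ u→γ = inj₁ (triangleHole D u→γ (subst (_⟶ w) (sym V.γ₀) (chords w)) (chords u)
                             ¬γ→u (λ w→γ → unabs (f w) (f∈ (f w))
                                (⊥-elim (ℕₚ.1+n≢0 (sym (V.Q.β-injective z≤n ≤-refl (V.Q.v→⇒β (V.Q.β∈ z≤n) w→γ))))))
                             ¬u→ffu)
          where
          ¬γ→u : ¬ γ 0 ⟶ u
          ¬γ→u γ→u with insemi u (γ 0) v γ→u (f→ u) (apart (f w) (V.Q.β∈ z≤n) V.v∉x)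
          ... | inj₁ γ→v = ¬γ→v γ→v
          ... | inj₂ v→γ = V.¬v→γ₀ v→γ
        ...   | inj₁ γ→u with insemi u (γ 0) v γ→u (f→ u) (apart (f w) (V.Q.β∈ z≤n) V.v∉x)
        ...     | inj₁ γ→v = ⊥-elim (¬γ→v γ→v)
        ...     | inj₂ v→γ₀ = ⊥-elim (V.¬v→γ₀ v→γ₀)
        step₃ (suc k₁) refl with shift chords (s≤s z≤n) pw
        ... | ε , px , _ with T? (adj D (ε 0) w)
        ...   | yes ε→w = inj₁ (Consecutive.chordHole pw px ε→w)
        ...   | no ¬ε→w = inj₁ (LongPaths.hole pv pw px ¬γ→v ¬ε→w)

-- Reversal and the residues in `J-big`

reverse : ∀ {n} → Digraph n → Digraph n
reverse D = record { adj = λ u v → adj D v u ; loopless = loopless D }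

-- With `J-big⇐` this replaces `J-big m` by the interval `1 ≤ d ≤ m − 2`: of the nonzero residues
-- only `−1` is missing.
J-big⇒ : ∀ {m d} → 3 ≤ m → J-big m d → d + 2 ≤ m
J-big⇒ 3≤m (inj₁ refl) = 3≤m
J-big⇒ {m} {d} 3≤m (inj₂ (_ , 2≤d , d≤m/2 , inj₁ refl)) = begin
  d + 2          ≤⟨ ℕₚ.+-monoʳ-≤ d 2≤d ⟩
  d + d          ≡⟨ cong (d +_) (ℕₚ.+-identityʳ d) ⟨
  2 * d          ≡⟨ ℕₚ.*-comm 2 d ⟩
  d * 2          ≤⟨ ℕₚ.*-monoˡ-≤ 2 d≤m/2 ⟩
  (m / 2) * 2    ≤⟨ m/n*n≤m m 2 ⟩
  m              ∎
  where open ℕₚ.≤-Reasoning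
J-big⇒ {m} {d} 3≤m (inj₂ (k , 2≤k , _ , inj₂ refl)) = ℕₚ.+-monoʳ-≤ d 2≤k

J-big⇐ : ∀ {m d} → 1 ≤ d → d + 2 ≤ m → J-big m d
J-big⇐ {m} {suc zero} _ _ = inj₁ refl
J-big⇐ {m} {d@(suc (suc _))} _ d+2≤m with d ≤? m / 2
... | yes d≤ = inj₂ (d , s≤s (s≤s z≤n) , d≤ , inj₁ refl)
... | no d≰  = inj₂ (m ∸ d , 2≤k , k≤ , inj₂ (ℕₚ.m+[n∸m]≡n d≤m))
  where
  open ℕₚ.≤-Reasoning
  d≤m : d ≤ m
  d≤m = ≤-trans (ℕₚ.m≤m+n d 2) d+2≤m
  2≤k : 2 ≤ m ∸ d
  2≤k = ℕₚ.m+n≤o⇒m≤o∸n 2 (subst (_≤ m) (ℕₚ.+-comm d 2) d+2≤m)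
  k≤ : m ∸ d ≤ m / 2
  k≤ = ℕₚ.m≤n+o⇒m∸n≤o m d (begin
    m                     ≡⟨ m≡m%n+[m/n]*n m 2 ⟩
    m % 2 + m / 2 * 2     ≤⟨ ℕₚ.+-monoˡ-≤ (m / 2 * 2) (s≤s⁻¹ (m%n<n m 2)) ⟩
    1 + m / 2 * 2         ≡⟨ cong suc (trans (ℕₚ.*-comm (m / 2) 2) (cong (m / 2 +_) (ℕₚ.+-identityʳ (m / 2)))) ⟩
    suc (m / 2) + m / 2   ≤⟨ ℕₚ.+-monoˡ-≤ (m / 2) (ℕₚ.≰⇒> d≰) ⟩
    d + m / 2             ∎)

-- Apart from `a = b`, the excluded pairs are those with `a ≡ b + 1` modulo `m`, the wrap-around
-- being listed separately; they realise the missing residue `−1`.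
big-offset : ∀ {m} a b → a < m → b < m → a ≢ b → suc b ≢ a → ¬ (suc b ≡ m × a ≡ 0) →
             ∃[ e ] (J-big m e × 1 ≤ e × e < m × (a + e ≡ b ⊎ a + e ≡ b + m))
big-offset {m} a b a<m b<m a≢b b+1≢a ¬wrap with compare a b
... | equal _ = ⊥-elim (a≢b refl)
... | less _ i = suc i , J-big⇐ (s≤s z≤n) (subst (_≤ m) (ℕₚ.+-comm 2 (suc i)) 3+i≤m) , s≤s z≤n
               , ≤-trans (n≤1+n _) 3+i≤m , inj₁ (ℕₚ.+-suc a i)
  where
  bound : ∀ a → suc (suc (a + i)) ≤ m → ¬ (suc (suc (a + i)) ≡ m × a ≡ 0) → suc (suc (suc i)) ≤ m
  bound (suc a) le _ = ≤-trans (s≤s (s≤s (s≤s (ℕₚ.m≤n+m i a)))) le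
  bound zero    le ¬wrap with m≤n⇒m<n∨m≡n le
  ... | inj₁ lt = lt
  ... | inj₂ eq = ⊥-elim (¬wrap (eq , refl))
  3+i≤m : suc (suc (suc i)) ≤ m
  3+i≤m = bound a b<m ¬wrap
... | greater _ zero = ⊥-elim (b+1≢a (cong suc (sym (ℕₚ.+-identityʳ b))))
... | greater _ (suc i) = e , J-big⇐ 1≤e e+2≤m , 1≤e , e<m , inj₂ eq
  where
  e = m ∸ suc (suc i)
  2+i<m : suc (suc i) < m
  2+i<m = ≤-trans (s≤s (s≤s (ℕₚ.m≤n+m (suc i) b))) a<m
  1≤e : 1 ≤ e
  1≤e = ℕₚ.m<n⇒0<n∸m 2+i<m
  e+2+i : e + suc (suc i) ≡ m
  e+2+i = ℕₚ.m∸n+n≡m (ℕₚ.<⇒≤ 2+i<m)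
  e+2≤m : e + 2 ≤ m
  e+2≤m = subst (e + 2 ≤_) e+2+i (ℕₚ.+-monoʳ-≤ e (s≤s (s≤s z≤n)))
  e<m : e < m
  e<m = ≤-trans (subst (_≤ e + 2) (ℕₚ.+-comm e 1) (ℕₚ.+-monoʳ-≤ e (s≤s z≤n))) e+2≤m
  eq : suc (b + suc i) + e ≡ b + m
  eq = trans (cong (_+ e) (sym (ℕₚ.+-suc b (suc i))))
        (trans (ℕₚ.+-assoc b (suc (suc i)) e)
          (cong (b +_) (trans (ℕₚ.+-comm (suc (suc i)) e) e+2+i)))

-- All arcs `u → f (f u)` present: a semicomplete circulant

module Tight {n} (D : Digraph n) (insemi : LocallyInSemicomplete D) (sys : KernelSystem D)
             (tight : ∀ u → Arc D u (KernelSystem.f sys (KernelSystem.f sys u))) where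
  open InSystem D insemi sys

  it : ℕ → Fin n → Fin n
  it zero    x = x
  it (suc i) x = f (it i x)

  it-+ : ∀ i j x → it i (it j x) ≡ it (i + j) x
  it-+ zero    j x = refl
  it-+ (suc i) j x = cong f (it-+ i j x)

  -- An invariant along the orbit of `y`: in the kernel of its `t`-th iterate, only the next iterate
  -- can be adjacent to `y`.
  record Reach (y : Fin n) (t : ℕ) : Set where
    field
      y∉   : y ∉ S (it t y)
      into : ∀ {s} → s ∈ S (it t y) → s ⟶ y → s ≡ it (suc t) y
      out  : ∀ {s} → s ∈ S (it t y) → y ⟶ s → s ≡ it (suc t) y

  reach₀ : ∀ y → Reach y 0
  reach₀ y = record { y∉ = self∉ y ; into = into-v y ; out = λ s∈ y→s → ⊥-elim (unabs y s∈ y→s) }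

  -- Since `w → y`, `y` is outside `S w` and must be absorbed there. A candidate entered from `a` is
  -- `f w` by `tight a` and `v-out`; any other leads through the invariant back to `w`, which
  -- neither lies in `S w` nor has an arc into it.
  reach₊ : ∀ y t → Reach y t → it (suc t) y ⟶ y → Reach y (suc t) × y ⟶ it (suc (suc t)) y
  reach₊ y t rch w→y = record { y∉ = y∉′ ; into = into′ ; out = out′ } , y→
    where
    open Reach rch
    a = it t y
    w = f a
    y∉′ : y ∉ S w
    y∉′ y∈ = unabs w y∈ w→y
    into′ : ∀ {s} → s ∈ S w → s ⟶ y → s ≡ f w
    into′ {s} s∈ s→y with insemi y s w s→y w→y (apart w s∈ (self∉ w))
    ... | inj₁ s→w = into-v w s∈ s→w
    ... | inj₂ w→s = ⊥-elim (unabs w s∈ w→s)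
    out′ : ∀ {s} → s ∈ S w → y ⟶ s → s ≡ f w
    out′ {s} s∈ y→s with T? (S a s)
    ... | yes s∈a with refl ← out s∈a y→s = ⊥-elim (self∉ w s∈)
    ... | no s∉a with Pair.predB a s∈ s∉a
    ...   | inj₁ refl = Pair.v-out a s∈ (f∈ w) (Pair.v→y a) (tight a)
    ...   | inj₂ (r , r∈ , r→s) with insemi s r y r→s y→s (apart a r∈ y∉)
    ...     | inj₁ r→y with refl ← into r∈ r→y = ⊥-elim (unabs w s∈ r→s)
    ...     | inj₂ y→r with refl ← out r∈ y→r  = ⊥-elim (unabs w s∈ r→s)
    y→ : y ⟶ f w
    y→ = let s , s∈ , y→s = absorb w (loop-free D w→y ∘ sym) y∉′
         in subst (y ⟶_) (out′ s∈ y→s) y→s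

  Miss : ℕ → Set
  Miss d = ∃[ x ] ¬ it (suc d) x ⟶ x

  miss? : ∀ d → Dec (Miss d)
  miss? d = any? λ x → ¬? (T? (adj D (it (suc d) x) x))

  -- The orbit of `x` repeats, so some iterate of `x` returns to itself, and there are no loops.
  someMiss : Fin n → ∃[ d ] Miss d
  someMiss x =
    let i , j , i<j , eq = pigeonhole (≤-refl {suc n}) (λ i → it (toℕ i) x)
        d , i+d≡j = ℕₚ.m≤n⇒∃[o]m+o≡n i<j
        returns = trans (it-+ (suc d) (toℕ i) x)
          (trans (cong (λ t → it t x) (trans (cong suc (ℕₚ.+-comm d (toℕ i))) i+d≡j)) (sym eq))
    in d , it (toℕ i) x , λ arc → loop-free D arc returns

  leastMiss : Fin n → ∃[ d ] (Miss d × ∀ i → i < d → ¬ Miss i)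
  leastMiss x with d , miss ← someMiss x with least miss? (suc d)
  ... | inj₁ none  = ⊥-elim (none d ≤-refl miss)
  ... | inj₂ found = found

  -- On `X 0, …, X (d + 1)` minimality gives all arcs with decreasing index except
  -- `X (d + 1) → X 0`, and `reach₊` all arcs raising the index by at least 2, while `asym` excludes
  -- steps by 1. With the arcs reversed, exactly the residue `−1` is missing modulo `m = d + 2`.
  module Clique (d : ℕ) (x : Fin n) (¬back : ¬ it (suc d) x ⟶ x) (before : ∀ i → i < d → ¬ Miss i) where
    X : ℕ → Fin n
    X s = it s x

    m : ℕ
    m = suc (suc d)

    1≤d : 1 ≤ d
    1≤d = ℕₚ.n≢0⇒n>0 λ { refl → ¬back (f→ x) }

    forward : ∀ y i → i < d → it (suc i) y ⟶ y
    forward y i i<d with T? (adj D (it (suc i) y) y)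
    ... | yes e = e
    ... | no ¬e = ⊥-elim (before i i<d (y , ¬e))

    reach : ∀ y t → t ≤ d → Reach y t
    reach y zero    _   = reach₀ y
    reach y (suc t) t<d = proj₁ (reach₊ y t (reach y t (ℕₚ.<⇒≤ t<d)) (forward y t t<d))

    backward : ∀ y i → i < d → y ⟶ it (suc (suc i)) y
    backward y i i<d = proj₂ (reach₊ y i (reach y i (ℕₚ.<⇒≤ i<d)) (forward y i i<d))

    forwardX : ∀ s i → i < d → X (suc (s + i)) ⟶ X s
    forwardX s i i<d = subst (_⟶ X s) (trans (it-+ (suc i) s x) (cong (λ t → it (suc t) x) (ℕₚ.+-comm i s)))
                         (forward (X s) i i<d)

    backwardX : ∀ s i → i < d → X s ⟶ X (s + suc (suc i))
    backwardX s i i<d = subst (X s ⟶_) (trans (it-+ (suc (suc i)) s x) (cong X (ℕₚ.+-comm (suc (suc i)) s)))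
                          (backward (X s) i i<d)

    toCirc : ∀ a b → a < m → b < m → X b ⟶ X a →
             ∃[ e ] (J-big m e × 1 ≤ e × e < m × (a + e ≡ b ⊎ a + e ≡ b + m))
    toCirc a b a<m b<m arc = big-offset a b a<m b<m
      (λ { refl → loop-free D arc refl }) (λ { refl → asym (X b) arc }) (λ { (refl , refl) → ¬back arc })

    fromCirc : ∀ a b → a < m → b < m →
               ∃[ e ] (J-big m e × 1 ≤ e × e < m × (a + e ≡ b ⊎ a + e ≡ b + m)) → X b ⟶ X a
    fromCirc a _ _ _ (suc i , J , _ , _ , inj₁ refl) =
      subst (λ t → X t ⟶ X a) (sym (ℕₚ.+-suc a i)) (forwardX a i i<d)
      where
      i<d : i < d
      i<d = s≤s⁻¹ (s≤s⁻¹ (subst (_≤ m) (ℕₚ.+-comm (suc i) 2) (J-big⇒ (s≤s (s≤s 1≤d)) J)))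
    fromCirc a b a<m _ (e , J , 1≤e , e<m , inj₂ eq) =
      subst (λ t → X b ⟶ X t) b+2+i≡a (backwardX b i i<d)
      where
      J′ : e + 2 ≤ m
      J′ = J-big⇒ (s≤s (s≤s 1≤d)) J
      i = d ∸ e
      2+i : suc (suc i) ≡ m ∸ e
      2+i = sym (ℕₚ.+-∸-assoc 2 {d} {e} (s≤s⁻¹ (s≤s⁻¹ (subst (_≤ m) (ℕₚ.+-comm e 2) J′))))
      i<d : i < d
      i<d = ℕₚ.∸-monoʳ-< 1≤e (s≤s⁻¹ (s≤s⁻¹ (subst (_≤ m) (ℕₚ.+-comm e 2) J′)))
      b+2+i≡a : b + suc (suc i) ≡ a
      b+2+i≡a = trans (cong (b +_) 2+i) (trans (sym (ℕₚ.+-∸-assoc b (ℕₚ.<⇒≤ e<m)))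
                  (trans (cong (_∸ e) (sym eq)) (ℕₚ.m+n∸n≡m a e)))

    X-apart : ∀ a i → suc (a + i) < m → X a ≢ X (suc (a + i))
    X-apart a i b<m eq with i ℕₚ.<? d
    ... | yes i<d = loop-free D (forwardX a i i<d) (sym eq)
    ... | no i≮d = loop-free D {X a} (subst (λ t → X a ⟶ X t) idx (backwardX a (i ∸ 1) i-1<d)) eq
      where
      i≤d : i ≤ d
      i≤d = ≤-trans (ℕₚ.m≤n+m i a) (s≤s⁻¹ (s≤s⁻¹ b<m))
      1≤i : 1 ≤ i
      1≤i = ≤-trans 1≤d (ℕₚ.≮⇒≥ i≮d)
      i-1<d : i ∸ 1 < d
      i-1<d = subst (_≤ d) (sym (ℕₚ.m+[n∸m]≡n 1≤i)) i≤d
      idx : a + suc (suc (i ∸ 1)) ≡ suc (a + i)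
      idx = trans (ℕₚ.+-suc a _) (cong (λ t → suc (a + t)) (ℕₚ.m+[n∸m]≡n 1≤i))

    X-injective : ∀ a b → a < m → b < m → X a ≡ X b → a ≡ b
    X-injective a b a<m b<m eq with compare a b
    ... | equal _     = refl
    ... | less _ i    = ⊥-elim (X-apart a i b<m eq)
    ... | greater _ i = ⊥-elim (X-apart b i a<m (sym eq))

    embedding : Embedding (reverse D) m (J-big m)
    embedding = record
      { h = X ∘ toℕ
      ; h-injective = λ {i} {j} eq → toℕ-injective (X-injective _ _ (toℕ<n i) (toℕ<n j) eq)
      ; arcs = λ i j → mk⇔ (toCirc _ _ (toℕ<n i) (toℕ<n j)) (fromCirc _ _ (toℕ<n i) (toℕ<n j)) }

  tightEmbedding : Fin n → ∃[ m ] (3 ≤ m × Embedding (reverse D) m (J-big m))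
  tightEmbedding x₀ with d , (x , ¬back) , before ← leastMiss x₀ =
    m , s≤s (s≤s 1≤d) , embedding
    where open Clique d x ¬back before

-- Circulants are isomorphic to their reverses, by `i ↦ m − 1 − i`

circ-opposite : ∀ {m J} (i j : Fin m) → CircArc m J (opposite j) (opposite i) → CircArc m J i j
circ-opposite {m} i j (d , J , 1≤d , d<m , e) = d , J , 1≤d , d<m , shifted e
  where
  sum-opposite : ∀ (i : Fin m) → toℕ (opposite i) + suc (toℕ i) ≡ m
  sum-opposite i = trans (cong (_+ suc (toℕ i)) (opposite-prop i)) (ℕₚ.m∸n+n≡m (toℕ<n i))

  regroup : ∀ a b o d → suc a + (o + suc b + d) ≡ (o + d) + (suc a + suc b)
  regroup = solve-∀

  cancel : ∀ z → toℕ (opposite j) + d ≡ toℕ (opposite i) + z → toℕ i + d ≡ toℕ j + z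
  cancel z e = ℕₚ.suc-injective (ℕₚ.+-cancelˡ-≡ m _ _ (begin
    m + suc (toℕ i + d)                                    ≡⟨ ℕₚ.+-suc m _ ⟩
    suc (m + (toℕ i + d))                                  ≡⟨ rearrange m (toℕ i) d ⟩
    suc (toℕ i) + (m + d)                                  ≡⟨ cong (λ t → suc (toℕ i) + (t + d)) (sum-opposite j) ⟨
    suc (toℕ i) + (toℕ (opposite j) + suc (toℕ j) + d)     ≡⟨ regroup (toℕ i) (toℕ j) (toℕ (opposite j)) d ⟩
    (toℕ (opposite j) + d) + (suc (toℕ i) + suc (toℕ j))   ≡⟨ cong (_+ (suc (toℕ i) + suc (toℕ j))) e ⟩
    (toℕ (opposite i) + z) + (suc (toℕ i) + suc (toℕ j))   ≡⟨ regroup′ (toℕ i) (toℕ j) (toℕ (opposite i)) z ⟩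
    (toℕ (opposite i) + suc (toℕ i)) + suc (toℕ j + z)     ≡⟨ cong (_+ suc (toℕ j + z)) (sum-opposite i) ⟩
    m + suc (toℕ j + z)                                    ∎))
    where
    open ≡-Reasoning
    rearrange : ∀ m a d → suc (m + (a + d)) ≡ suc a + (m + d)
    rearrange = solve-∀
    regroup′ : ∀ a b o z → (o + z) + (suc a + suc b) ≡ (o + suc a) + suc (b + z)
    regroup′ = solve-∀

  shifted : toℕ (opposite j) + d ≡ toℕ (opposite i) ⊎ toℕ (opposite j) + d ≡ toℕ (opposite i) + m →
            toℕ i + d ≡ toℕ j ⊎ toℕ i + d ≡ toℕ j + m
  shifted (inj₁ e) = inj₁ (trans (cancel 0 (trans e (sym (ℕₚ.+-identityʳ _)))) (ℕₚ.+-identityʳ _))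
  shifted (inj₂ e) = inj₂ (cancel m e)

reverseEmbedding : ∀ {n} (D : Digraph n) {m J} → Embedding (reverse D) m J → Embedding D m J
reverseEmbedding D {m} {J} emb = record
  { h = h ∘ opposite
  ; h-injective = λ {i} {j} eq →
      trans (sym (opposite-involutive i)) (trans (cong opposite (h-injective eq)) (opposite-involutive j))
  ; arcs = λ i j → mk⇔
      (λ arc → circ-opposite i j (Equivalence.to (arcs (opposite j) (opposite i)) arc))
      (λ c → Equivalence.from (arcs (opposite j) (opposite i))
        (circ-opposite (opposite j) (opposite i)
          (subst₂ (CircArc m J) (sym (opposite-involutive i)) (sym (opposite-involutive j)) c))) }
  where open Embedding emb

-- Kernelless circulants, and embeddings that must be onto

Kernelless : (m : ℕ) → (ℕ → Set) → Set
Kernelless m J = ∀ (S : VSet m) → (∀ i j → i ∈ S → j ∈ S → ¬ CircArc m J i j) →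
                 ¬ (∀ i → i ∉ S → ∃[ j ] (j ∈ S × CircArc m J i j))

-- If the image missed a vertex, it would have a kernel by criticality, and pulling this back along
-- `h` would give a kernel of the circulant.
embedding⇒iso : ∀ {n} (D : Digraph n) {m J} → CKI D → Kernelless m J → Embedding D m J → IsoCirc D m J
embedding⇒iso {n} D {m} {J} (_ , hereditary) kernelless emb =
  mk↔ₛ′ index h index-h h-index , λ u v → mk⇔
    (λ arc → Equivalence.to (arcs (index u) (index v)) (subst₂ (Arc D) (sym (h-index u)) (sym (h-index v)) arc))
    (λ c → subst₂ (Arc D) (h-index u) (h-index v) (Equivalence.from (arcs (index u) (index v)) c))
  where
  open Embedding emb

  hit? : ∀ u → Dec (∃[ i ] h i ≡ u)
  hit? u = any? λ i → h i ≟ u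

  Image : VSet n
  Image u = does (hit? u)

  h∈ : ∀ i → h i ∈ Image
  h∈ i with hit? (h i)
  ... | yes _   = tt
  ... | no miss = miss (i , refl)

  Image⇒ : ∀ {u} → u ∈ Image → ∃[ i ] h i ≡ u
  Image⇒ {u} u∈ with hit? u
  ... | yes hit = hit

  surjective : ∀ u → ∃[ i ] h i ≡ u
  surjective u with hit? u
  ... | yes hit = hit
  ... | no miss with hereditary Image (u , miss ∘ Image⇒)
  ...   | K , K⊆ , indepK , absorbK = ⊥-elim (kernelless (K ∘ h)
            (λ i j i∈ j∈ c → indepK (h i) (h j) i∈ j∈ (Equivalence.from (arcs i j) c))
            λ i i∉ → absorbed i (absorbK (h i) (h∈ i) i∉))
    where
    absorbed : ∀ i → ∃[ v ] (v ∈ K × Arc D (h i) v) → ∃[ j ] (h j ∈ K × CircArc m J i j)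
    absorbed i (v , v∈ , arc) with j , refl ← Image⇒ (K⊆ v v∈) = j , v∈ , Equivalence.to (arcs i j) arc

  index : Fin n → Fin m
  index u = proj₁ (surjective u)
  h-index : ∀ u → h (index u) ≡ u
  h-index u = proj₂ (surjective u)
  index-h : ∀ i → index (h i) ≡ i
  index-h i = h-injective (h-index (h i))

circ-next : ∀ {m J} {i j : Fin (suc (suc m))} → J 1 → suc (toℕ i) ≡ toℕ j → CircArc (suc (suc m)) J i j
circ-next {i = i} J1 e = 1 , J1 , s≤s z≤n , s≤s (s≤s z≤n) , inj₁ (trans (ℕₚ.+-comm (toℕ i) 1) e)

circ-wrap : ∀ {m J} {i : Fin (suc (suc m))} → J 1 → toℕ i ≡ suc m → CircArc (suc (suc m)) J i zero
circ-wrap {i = i} J1 e = 1 , J1 , s≤s z≤n , s≤s (s≤s z≤n) , inj₂ (trans (ℕₚ.+-comm (toℕ i) 1) (cong suc e))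

cycle-arc : ∀ {m} {i j : Fin m} → CircArc m J-cycle i j → suc (toℕ i) ≡ toℕ j ⊎ (suc (toℕ i) ≡ m × toℕ j ≡ 0)
cycle-arc {i = i} (_ , refl , _ , _ , inj₁ e) = inj₁ (trans (ℕₚ.+-comm 1 (toℕ i)) e)
cycle-arc {m} {i} {j} (_ , refl , _ , _ , inj₂ e) = inj₂ (ℕₚ.≤-antisym (toℕ<n i) m≤ , j≡0)
  where
  e′ : suc (toℕ i) ≡ toℕ j + m
  e′ = trans (ℕₚ.+-comm 1 (toℕ i)) e
  m≤ : m ≤ suc (toℕ i)
  m≤ = subst (m ≤_) (sym e′) (ℕₚ.m≤n+m m (toℕ j))
  j≡0 : toℕ j ≡ 0
  j≡0 = ℕₚ.n≤0⇒n≡0 (ℕₚ.+-cancelʳ-≤ m (toℕ j) 0 (subst (_≤ m) e′ (toℕ<n i)))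

-- Unlike `k + k`, this unfolds by two constructors at a time, matching two steps along a cycle.
double : ℕ → ℕ
double zero    = zero
double (suc k) = suc (suc (double k))

double≡ : ∀ k → double k ≡ k + k
double≡ zero    = refl
double≡ (suc k) = cong suc (trans (cong suc (double≡ k)) (sym (ℕₚ.+-suc k k)))

-- Membership in a kernel alternates along the cycle, yet the consecutive positions
-- `m − 1 = 2 (k + 1)` and 0 are both even.
oddCycle-kernelless : ∀ k → Kernelless (suc (suc (suc (k + k)))) J-cycle
oddCycle-kernelless k S indepS absorbS = decide (T? (S zero))
  where
  m = suc (suc (suc (k + k)))

  at : ∀ t → .(t < m) → Fin m
  at t t<m = fromℕ< t<m

  on-off : ∀ t (t<m : suc t < m) → at t (ℕₚ.<⇒≤ t<m) ∈ S → at (suc t) t<m ∉ S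
  on-off t t<m here next = indepS _ _ here next
    (circ-next refl (trans (cong suc (toℕ-fromℕ< (ℕₚ.<⇒≤ t<m))) (sym (toℕ-fromℕ< t<m))))

  off-on : ∀ t (t<m : suc t < m) → at t (ℕₚ.<⇒≤ t<m) ∉ S → at (suc t) t<m ∈ S
  off-on t t<m here with j , j∈ , c ← absorbS _ here with cycle-arc c
  ... | inj₁ e = subst (_∈ S) (toℕ-injective (trans (sym e) (trans (cong suc (toℕ-fromℕ< (ℕₚ.<⇒≤ t<m))) (sym (toℕ-fromℕ< t<m))))) j∈
  ... | inj₂ (e , _) = ⊥-elim (ℕₚ.<⇒≢ t<m (trans (cong suc (sym (toℕ-fromℕ< (ℕₚ.<⇒≤ t<m)))) e))

  even-on : ∀ j (j<m : double j < m) → zero ∈ S → at (double j) j<m ∈ S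
  even-on zero    _   z = z
  even-on (suc j) j<m z = off-on _ j<m (on-off _ (ℕₚ.<⇒≤ j<m) (even-on j (ℕₚ.<⇒≤ (ℕₚ.<⇒≤ j<m)) z))

  even-off : ∀ j (j<m : double j < m) → zero ∉ S → at (double j) j<m ∉ S
  even-off zero    _   z = z
  even-off (suc j) j<m z = on-off _ j<m (off-on _ (ℕₚ.<⇒≤ j<m) (even-off j (ℕₚ.<⇒≤ (ℕₚ.<⇒≤ j<m)) z))

  end : suc (double (suc k)) ≡ m
  end = cong (λ t → suc (suc (suc t))) (double≡ k)

  end<m : double (suc k) < m
  end<m = ℕₚ.≤-reflexive end

  toℕ-end : suc (toℕ (at (double (suc k)) end<m)) ≡ m
  toℕ-end = trans (cong suc (toℕ-fromℕ< end<m)) end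

  decide : Dec (zero ∈ S) → ⊥
  decide (yes z∈) = indepS _ _ (even-on (suc k) end<m z∈) z∈ (circ-wrap refl (ℕₚ.suc-injective toℕ-end))
  decide (no z∉) with j , j∈ , c ← absorbS _ (even-off (suc k) end<m z∉) with cycle-arc c
  ... | inj₁ e       = ℕₚ.<⇒≢ (toℕ<n j) (trans (sym e) toℕ-end)
  ... | inj₂ (_ , e) = z∉ (subst (_∈ S) (toℕ-injective e) j∈)

-- A kernel of C₇(1,2) is invariant under i ↦ i + 3, hence under i ↦ i + 15 = i + 1.
web7-empty : ∀ (S : VSet 7) → (∀ i j → i ∈ S → j ∈ S → ¬ CircArc 7 J-1-2 i j) →
             (∀ i → i ∉ S → ∃[ j ] (j ∈ S × CircArc 7 J-1-2 i j)) → ∀ {i} → i ∉ S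
web7-empty S indepS absorbS {i} i∈ =
  indepS i (i ⊕ 1) i∈ (subst (_∈ S) (fifteen i) (shift³ (shift³ (shift³ (shift³ (shift³ i∈)))))) (circ₁ i)
  where
  fifteen : ∀ i → i ⊕ 3 ⊕ 3 ⊕ 3 ⊕ 3 ⊕ 3 ≡ i ⊕ 1
  fifteen = from-yes (all? λ i → i ⊕ 3 ⊕ 3 ⊕ 3 ⊕ 3 ⊕ 3 ≟ i ⊕ 1)
  1+1 : ∀ i → i ⊕ 1 ⊕ 1 ≡ i ⊕ 2
  1+1 = from-yes (all? λ i → i ⊕ 1 ⊕ 1 ≟ i ⊕ 2)
  1+2 : ∀ i → i ⊕ 1 ⊕ 2 ≡ i ⊕ 3
  1+2 = from-yes (all? λ i → i ⊕ 1 ⊕ 2 ≟ i ⊕ 3)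
  shift³ : ∀ {i} → i ∈ S → i ⊕ 3 ∈ S
  shift³ {i} i∈ with j , j∈ , c ← absorbS (i ⊕ 1) (λ i+1∈ → indepS i (i ⊕ 1) i∈ i+1∈ (circ₁ i)) with jump (i ⊕ 1) j c
  ... | inj₁ refl = ⊥-elim (indepS i (i ⊕ 2) i∈ (subst (_∈ S) (1+1 i) j∈) (circ₂ i))
  ... | inj₂ refl = subst (_∈ S) (1+2 i) j∈

web7-kernelless : Kernelless 7 J-1-2
web7-kernelless S indepS absorbS with T? (S zero)
... | yes z∈ = web7-empty S indepS absorbS z∈
... | no z∉ with j , j∈ , _ ← absorbS zero z∉ = web7-empty S indepS absorbS j∈

-- Every vertex other than i and i + 1 has an arc to i, so S = {i}, and S does not absorb i + 1.
J-big-empty : ∀ m₀ (let m = suc (suc (suc m₀))) (S : VSet m) →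
              (∀ i j → i ∈ S → j ∈ S → ¬ CircArc m (J-big m) i j) →
              (∀ i → i ∉ S → ∃[ j ] (j ∈ S × CircArc m (J-big m) i j)) → ∀ {i} → i ∉ S
J-big-empty m₀ S indepS absorbS {i} i∈ = beyond (m≤n⇒m<n∨m≡n (toℕ<n i))
  where
  m = suc (suc (suc m₀))

  conclude : ∀ j → CircArc m (J-big m) i j → ¬ CircArc m (J-big m) j i →
             (∀ s → s ≢ j → suc (toℕ i) ≢ toℕ s × ¬ (suc (toℕ i) ≡ m × toℕ s ≡ 0)) → ⊥
  conclude j i→j ¬j→i others
    with s , s∈ , j→s ← absorbS j (λ j∈ → indepS i j i∈ j∈ i→j) with s ≟ i | s ≟ j
  ... | yes refl | _        = ¬j→i j→s
  ... | no _     | yes refl = indepS i j i∈ s∈ i→j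
  ... | no s≢i   | no s≢j   = let ¬next , ¬wrap = others s s≢j in
    indepS s i s∈ i∈ (big-offset (toℕ s) (toℕ i) (toℕ<n s) (toℕ<n i) (s≢i ∘ toℕ-injective) ¬next ¬wrap)

  beyond : suc (toℕ i) < m ⊎ suc (toℕ i) ≡ m → ⊥
  beyond (inj₁ i+1<m) = conclude j (circ-next (inj₁ refl) (sym j≡)) ¬j→i
      λ s s≢j → (λ eq → s≢j (toℕ-injective (trans (sym eq) (sym j≡)))) , λ (eq , _) → ℕₚ.<⇒≢ i+1<m eq
    where
    j = fromℕ< i+1<m
    j≡ : toℕ j ≡ suc (toℕ i)
    j≡ = toℕ-fromℕ< i+1<m
    ¬j→i : ¬ CircArc m (J-big m) j i
    ¬j→i (d , J , _ , _ , inj₁ e) = ℕₚ.<⇒≢ (s≤s (ℕₚ.m≤m+n (toℕ i) d)) (sym (trans (cong (_+ d) (sym j≡)) e))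
    ¬j→i (d , J , _ , _ , inj₂ e) = 1+n≰n (subst (_≤ m) (trans (ℕₚ.+-comm d 2) (cong suc 1+d≡m)) (J-big⇒ (s≤s (s≤s (s≤s z≤n))) J))
      where
      1+d≡m : suc d ≡ m
      1+d≡m = ℕₚ.+-cancelˡ-≡ (toℕ i) _ _ (trans (ℕₚ.+-suc (toℕ i) d) (trans (cong (_+ d) (sym j≡)) e))
  beyond (inj₂ i+1≡m) = conclude zero (circ-wrap (inj₁ refl) (ℕₚ.suc-injective i+1≡m)) ¬j→i
      λ s s≢j → (λ eq → ℕₚ.<⇒≢ (toℕ<n s) (trans (sym eq) i+1≡m)) , λ (_ , eq) → s≢j (toℕ-injective eq)
    where
    ¬j→i : ¬ CircArc m (J-big m) zero i
    ¬j→i (d , J , _ , _ , inj₁ refl) =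
      1+n≰n (subst (_≤ m) (trans (ℕₚ.+-comm d 2) (cong suc i+1≡m)) (J-big⇒ (s≤s (s≤s (s≤s z≤n))) J))
    ¬j→i (d , J , _ , d<m , inj₂ e) = ℕₚ.<⇒≱ d<m (subst (m ≤_) (sym e) (ℕₚ.m≤n+m m (toℕ i)))

J-big-kernelless : ∀ m → 3 ≤ m → Kernelless m (J-big m)
J-big-kernelless (suc zero) (s≤s ())
J-big-kernelless (suc (suc zero)) (s≤s (s≤s ()))
J-big-kernelless m@(suc (suc (suc m₀))) 3≤m S indepS absorbS with T? (S zero)
... | no z∉ with j , j∈ , _ ← absorbS zero z∉ = J-big-empty m₀ S indepS absorbS j∈
... | yes z∈ = J-big-empty m₀ S indepS absorbS z∈

oddHole⇒embedding : ∀ {n} (D : Digraph n) → OddHole D →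
                    ∃[ k ] Embedding D (suc (suc (suc (k + k)))) J-cycle
oddHole⇒embedding {n} D hole = r , record
  { h = walk r ∘ toℕ
  ; h-injective = λ {i} {j} → injective i j
  ; arcs = λ i j → mk⇔ (to i j) (from i j) }
  where
  open OddHole hole

  length : ℕ → ℕ
  length t = suc (suc (suc (t + t)))

  m = length r

  -- The vertices in cyclic order, starting from P t.
  walk : ℕ → ℕ → Fin n
  walk t       zero          = P t
  walk t       (suc zero)    = Q t
  walk zero    (suc (suc _)) = v
  walk (suc t) (suc (suc s)) = walk t s

  -- The positions `2 (t − i)` of `P i`, `2 (t − i) + 1` of `Q i` and `2t + 2` of `v`, written
  -- without subtraction.
  data At (t s : ℕ) : Fin n → Set where
    atP : ∀ {i} → i ≤ t → s + (i + i) ≡ t + t → At t s (P i)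
    atQ : ∀ {i} → i ≤ t → s + (i + i) ≡ suc (t + t) → At t s (Q i)
    atV : s ≡ suc (suc (t + t)) → At t s v

  2+ : ∀ t → suc t + suc t ≡ suc (suc (t + t))
  2+ = solve-∀

  at : ∀ t s → s < length t → At t s (walk t s)
  at t       zero       _ = atP ≤-refl refl
  at t       (suc zero) _ = atQ ≤-refl refl
  at zero    (suc (suc zero)) _ = atV refl
  at zero    (suc (suc (suc _))) (s≤s (s≤s (s≤s ())))
  at (suc t) (suc (suc s)) s<m
    with walk t s | at t s (s≤s⁻¹ (s≤s⁻¹ (subst (suc (suc (suc s)) ≤_) (cong (3 +_) (2+ t)) s<m)))
  ... | _ | atP i≤t e = atP (≤-trans i≤t (n≤1+n t)) (trans (cong (2 +_) e) (sym (2+ t)))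
  ... | _ | atQ i≤t e = atQ (≤-trans i≤t (n≤1+n t)) (trans (cong (2 +_) e) (cong suc (sym (2+ t))))
  ... | _ | atV e     = atV (trans (cong (2 +_) e) (cong (2 +_) (sym (2+ t))))

  next : ∀ t s → t ≤ r → suc s < length t → Arc D (walk t s) (walk t (suc s))
  next t       zero       t≤r _ = P→Q t≤r
  next zero    (suc zero) t≤r _ = Q→v
  next (suc t) (suc zero) t≤r _ = Q→P t≤r
  next zero    (suc (suc s)) _ (s≤s (s≤s (s≤s ())))
  next (suc t) (suc (suc s)) t≤r s<m = next t s (ℕₚ.<⇒≤ t≤r)
    (s≤s⁻¹ (s≤s⁻¹ (subst (suc (suc (suc (suc s))) ≤_) (cong (3 +_) (2+ t)) s<m)))

  end : ∀ t s → s ≡ suc (suc (t + t)) → walk t s ≡ v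
  end zero    _ refl = refl
  end (suc t) _ refl = end t _ (2+ t)

  succ-cancel : ∀ {a b c} x → a + x ≡ c → b + x ≡ suc c → suc a ≡ b
  succ-cancel x e e′ = ℕₚ.+-cancelʳ-≡ x _ _ (trans (cong suc e) (sym e′))

  arcsAt : ∀ {s s′ a b} → At r s a → At r s′ b → Arc D a b → suc s ≡ s′ ⊎ (suc s ≡ m × s′ ≡ 0)
  arcsAt (atP i≤ _) (atP j≤ _) arc = ⊥-elim (¬P→P i≤ j≤ arc)
  arcsAt (atP {i} i≤ e) (atQ j≤ e′) arc with refl ← P→Q⇒ i≤ j≤ arc = inj₁ (succ-cancel (i + i) e e′)
  arcsAt (atP i≤ _) (atV _) arc = ⊥-elim (¬P→v i≤ arc)
  arcsAt {s} {s′} (atQ i≤ e) (atP {j} j≤ e′) arc with refl ← Q→P⇒ i≤ j≤ arc =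
    inj₁ (ℕₚ.+-cancelʳ-≡ (j + j) _ _ (trans (ℕₚ.suc-injective (trans (shift s j) e)) (sym e′)))
    where
    shift : ∀ s j → suc (suc s + (j + j)) ≡ s + (suc j + suc j)
    shift = solve-∀
  arcsAt (atQ i≤ _) (atQ j≤ _) arc = ⊥-elim (¬Q→Q i≤ j≤ arc)
  arcsAt {s} (atQ i≤ e) (atV e′) arc with refl ← Q→v⇒ i≤ arc =
    inj₁ (trans (cong suc (trans (sym (ℕₚ.+-identityʳ s)) e)) (sym e′))
  arcsAt {s′ = s′} (atV e) (atP j≤ e′) arc with refl ← v→P⇒ j≤ arc =
    inj₂ (cong suc e , ℕₚ.+-cancelʳ-≡ (r + r) s′ 0 e′)
  arcsAt (atV _) (atQ j≤ _) arc = ⊥-elim (¬v→Q j≤ arc)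
  arcsAt (atV _) (atV _) arc = ⊥-elim (loop-free D arc refl)

  arcs⇒ : ∀ (i j : Fin m) → Arc D (walk r (toℕ i)) (walk r (toℕ j)) →
          suc (toℕ i) ≡ toℕ j ⊎ (suc (toℕ i) ≡ m × toℕ j ≡ 0)
  arcs⇒ i j arc = arcsAt (at r (toℕ i) (toℕ<n i)) (at r (toℕ j) (toℕ<n j)) arc

  to : ∀ i j → Arc D (walk r (toℕ i)) (walk r (toℕ j)) → CircArc m J-cycle i j
  to i j arc with arcs⇒ i j arc
  ... | inj₁ e       = circ-next refl e
  ... | inj₂ (e , z) = subst (CircArc m J-cycle i) (toℕ-injective (sym z)) (circ-wrap refl (ℕₚ.suc-injective e))

  arc-next : ∀ (i j : Fin m) → suc (toℕ i) ≡ toℕ j ⊎ (suc (toℕ i) ≡ m × toℕ j ≡ 0) →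
             Arc D (walk r (toℕ i)) (walk r (toℕ j))
  arc-next i j (inj₁ e) = subst (λ t → Arc D (walk r (toℕ i)) (walk r t)) e
    (next r (toℕ i) ≤-refl (subst (_< m) (sym e) (toℕ<n j)))
  arc-next i j (inj₂ (e , z)) = subst₂ (λ a t → Arc D a (walk r t))
    (sym (end r (toℕ i) (ℕₚ.suc-injective e))) (sym z) v→P

  from : ∀ i j → CircArc m J-cycle i j → Arc D (walk r (toℕ i)) (walk r (toℕ j))
  from i j c = arc-next i j (cycle-arc c)

  -- Equal vertices have the same out-neighbours, and by `arcs⇒` the position of the head of an arc
  -- determines that of its tail.
  injective : ∀ i j → walk r (toℕ i) ≡ walk r (toℕ j) → i ≡ j
  injective i j eq with m≤n⇒m<n∨m≡n (toℕ<n i)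
  ... | inj₁ i+1<m = shared (arcs⇒ j t (subst (λ z → Arc D z (walk r (toℕ t))) eq (arc-next i t (inj₁ t-next))))
    where
    t = fromℕ< i+1<m
    t-next : suc (toℕ i) ≡ toℕ t
    t-next = sym (toℕ-fromℕ< i+1<m)
    shared : suc (toℕ j) ≡ toℕ t ⊎ (suc (toℕ j) ≡ m × toℕ t ≡ 0) → i ≡ j
    shared (inj₁ e)       = toℕ-injective (ℕₚ.suc-injective (trans t-next (sym e)))
    shared (inj₂ (_ , z)) = ⊥-elim (ℕₚ.1+n≢0 (trans t-next z))
  ... | inj₂ i+1≡m
    with arcs⇒ j zero (subst (λ z → Arc D z (P r)) eq (arc-next i zero (inj₂ (i+1≡m , refl))))
  ... | inj₂ (e , _) = toℕ-injective (ℕₚ.suc-injective (trans i+1≡m (sym e)))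

-- From kernel systems to the classification

Obstruction : ∀ {n} → Digraph n → Set
Obstruction D = (∃[ k ] Embedding D (suc (suc (suc (k + k)))) J-cycle) ⊎
                Embedding D 7 J-1-2 ⊎ (∃[ m ] (4 ≤ m × Embedding D m (J-big m)))

-- For `m = 3` the only residue in `J-big` is 1, so the circulant is a directed triangle and counts
-- as an odd cycle.
big-obstruction : ∀ {n} (D : Digraph n) {m} → 3 ≤ m → Embedding D m (J-big m) → Obstruction D
big-obstruction D {m} 3≤m emb with m≤n⇒m<n∨m≡n 3≤m
... | inj₁ 4≤m  = inj₂ (inj₂ (m , 4≤m , emb))
... | inj₂ refl = inj₁ (0 , record
  { h = h ; h-injective = h-injective
  ; arcs = λ i j → mk⇔ (to-cycle ∘ Equivalence.to (arcs i j)) (Equivalence.from (arcs i j) ∘ from-cycle) })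
  where
  open Embedding emb
  to-cycle : ∀ {i j} → CircArc 3 (J-big 3) i j → CircArc 3 J-cycle i j
  to-cycle (d , J , 1≤d , d<3 , e) = d , ℕₚ.≤-antisym (ℕₚ.+-cancelʳ-≤ 2 d 1 (J-big⇒ ≤-refl J)) 1≤d , 1≤d , d<3 , e
  from-cycle : ∀ {i j} → CircArc 3 J-cycle i j → CircArc 3 (J-big 3) i j
  from-cycle (d , J , rest) = d , inj₁ J , rest

reverseObstruction : ∀ {n} (D : Digraph n) → Obstruction (reverse D) → Obstruction D
reverseObstruction D (inj₁ (k , emb))              = inj₁ (k , reverseEmbedding D emb)
reverseObstruction D (inj₂ (inj₁ emb))             = inj₂ (inj₁ (reverseEmbedding D emb))
reverseObstruction D (inj₂ (inj₂ (m , 4≤m , emb))) = inj₂ (inj₂ (m , 4≤m , reverseEmbedding D emb))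

-- The second split separates the tight case: `v → f (f v)` holds exactly when the cycle through `v`
-- has `k = 0`.
obstruction : ∀ {n} (D : Digraph n) → LocallyInSemicomplete D → KernelSystem D → Fin n → Obstruction D
obstruction {n} D insemi sys x₀ with any? (λ v → ¬? (T? (adj D (f (f v)) v)))
  where open KernelSystem sys
... | yes (v , ¬chord) = inj₁ (oddHole⇒embedding D (Shifts.chordless D insemi sys v ¬chord))
... | no ¬chordless with any? (λ v → ¬? (T? (adj D v (f (f v)))))
  where open KernelSystem sys
...   | no ¬loose = let m , 3≤m , emb = Tight.tightEmbedding D insemi sys tight x₀ in
                    big-obstruction D 3≤m (reverseEmbedding D emb)
  where
  open KernelSystem sys
  tight : ∀ u → Arc D u (f (f u))
  tight u with T? (adj D u (f (f u)))
  ... | yes e = e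
  ... | no ¬e = ⊥-elim (¬loose (u , ¬e))
...   | yes (u , ¬u→) with Loose.long D insemi sys chords u ¬u→
  where
  open KernelSystem sys
  chords : ∀ u → Arc D (f (f u)) u
  chords u with T? (adj D (f (f u)) u)
  ... | yes e = e
  ... | no ¬e = ⊥-elim (¬chordless (u , ¬e))
...     | inj₁ hole = inj₁ (oddHole⇒embedding D hole)
...     | inj₂ web  = inj₂ (inj₁ (web7⇒embedding D web))

classify : ∀ {n} (D : Digraph n) → CKI D → Obstruction D →
           IsDirectedOddCycle D ⊎ IsoCirc D 7 J-1-2 ⊎ (∃[ m ] (4 ≤ m × IsoCirc D m (J-big m)))
classify D cki (inj₁ (k , emb))  = inj₁ (k , embedding⇒iso D cki (oddCycle-kernelless k) emb)
classify D cki (inj₂ (inj₁ emb)) = inj₂ (inj₁ (embedding⇒iso D cki web7-kernelless emb))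
classify D cki (inj₂ (inj₂ (m , 4≤m , emb))) =
  inj₂ (inj₂ (m , 4≤m , embedding⇒iso D cki (J-big-kernelless m (≤-trans (n≤1+n 3) 4≤m)) emb))

cki⇒inhabited : ∀ {n} (D : Digraph n) → CKI D → Fin n
cki⇒inhabited {zero}  D (noKernel , _) = ⊥-elim (noKernel ((λ ()) , (λ ()) , (λ ()) , (λ ())))
cki⇒inhabited {suc n} D _              = zero

-- Duality in the locally out-semicomplete case

open ≡-Reasoning

-- Linear algebra over the integers

*ᶻ-nonzero : ∀ {i j} → i ≢ 0ℤ → j ≢ 0ℤ → i *ᶻ j ≢ 0ℤ
*ᶻ-nonzero {i} i≢0 j≢0 eq with ℤₚ.i*j≡0⇒i≡0∨j≡0 i eq
... | inj₁ i≡0 = i≢0 i≡0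
... | inj₂ j≡0 = j≢0 j≡0

nonzero-factor : ∀ {i j} → j ≢ 0ℤ → i *ᶻ j ≡ 0ℤ → i ≡ 0ℤ
nonzero-factor {i} j≢0 eq with ℤₚ.i*j≡0⇒i≡0∨j≡0 i eq
... | inj₁ i≡0 = i≡0
... | inj₂ j≡0 = ⊥-elim (j≢0 j≡0)

infix 8 _·_
_·_ : ∀ {n} → (Fin n → ℤ) → (Fin n → ℤ) → ℤ
a · b = sum λ j → a j *ᶻ b j

·-congʳ : ∀ {n} (a : Fin n → ℤ) {b c} → (∀ j → b j ≡ c j) → a · b ≡ a · c
·-congʳ a b≗c = sum-cong-≗ λ j → cong (a j *ᶻ_) (b≗c j)

·-zeroʳ : ∀ {n} (a : Fin n → ℤ) → a · (λ _ → 0ℤ) ≡ 0ℤ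
·-zeroʳ {n} a = trans (sum-cong-≗ λ j → ℤₚ.*-zeroʳ (a j)) (sum-replicate-zero n)

·-scale : ∀ {n} (a b : Fin n → ℤ) c → a · (λ j → c *ᶻ b j) ≡ c *ᶻ a · b
·-scale a b c = trans (sum-cong-≗ λ j → swap (a j) c (b j)) (sym (*-distribˡ-sum c (λ j → a j *ᶻ b j)))
  where
  swap : ∀ x c y → x *ᶻ (c *ᶻ y) ≡ c *ᶻ (x *ᶻ y)
  swap = ℤ-Solver.solve-∀

·-+ : ∀ {n} (a b c : Fin n → ℤ) → a · (λ j → b j +ᶻ c j) ≡ a · b +ᶻ a · c
·-+ a b c = trans (sum-cong-≗ λ j → ℤₚ.*-distribˡ-+ (a j) (b j) (c j))
                         (∑-distrib-+ (λ j → a j *ᶻ b j) (λ j → a j *ᶻ c j))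

·-assoc : ∀ {m n} (p : Fin m → ℤ) (s : Fin n → Fin m → ℤ) (b : Fin n → ℤ) →
          p · (λ w → (λ v → s v w) · b) ≡ (λ v → p · s v) · b
·-assoc p s b = begin
  sum (λ w → p w *ᶻ sum (λ v → s v w *ᶻ b v))        ≡⟨ sum-cong-≗ (λ w → *-distribˡ-sum (p w) (λ v → s v w *ᶻ b v)) ⟩
  sum (λ w → sum (λ v → p w *ᶻ (s v w *ᶻ b v)))      ≡⟨ ∑-comm (λ w v → p w *ᶻ (s v w *ᶻ b v)) ⟩
  sum (λ v → sum (λ w → p w *ᶻ (s v w *ᶻ b v)))      ≡⟨ sum-cong-≗ (λ v → sum-cong-≗ λ w → ℤₚ.*-assoc (p w) (s v w) (b v)) ⟨
  sum (λ v → sum (λ w → p w *ᶻ s v w *ᶻ b v))        ≡⟨ sum-cong-≗ (λ v → *-distribʳ-sum (b v) (λ w → p w *ᶻ s v w)) ⟨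
  sum (λ v → p · s v *ᶻ b v)                         ∎

-- By fraction-free Gaussian elimination.
underdetermined : ∀ k (A : Fin k → Fin (suc k) → ℤ) →
                  ∃[ y ] ((∃[ j ] y j ≢ 0ℤ) × ∀ i → A i · y ≡ 0ℤ)
underdetermined zero A = (λ _ → 1ℤ) , (zero , λ ()) , λ ()
underdetermined (suc k) A with any? (λ j → ¬? (A zero j ≟ᶻ 0ℤ))
... | no none with underdetermined k (λ i t → A (suc i) (suc t))
...   | z , (t , z≢0) , sol = y , (suc t , z≢0) , solves
  where
  y : Fin (suc (suc k)) → ℤ
  y zero    = 0ℤ
  y (suc t) = z t
  vanish : ∀ j → A zero j ≡ 0ℤ
  vanish j with A zero j ≟ᶻ 0ℤ
  ... | yes eq = eq
  ... | no ≢0  = ⊥-elim (none (j , ≢0))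
  solves : ∀ i → A i · y ≡ 0ℤ
  solves zero    = trans (sum-cong-≗ λ j → trans (cong (_*ᶻ y j) (vanish j)) (ℤₚ.*-zeroˡ (y j))) (sum-replicate-zero (suc (suc k)))
  solves (suc i) = trans (cong (_+ᶻ (λ t → A (suc i) (suc t)) · z) (ℤₚ.*-zeroʳ (A (suc i) zero)))
                         (trans (ℤₚ.+-identityˡ _) (sol i))
underdetermined (suc k) A | yes (j , c≢0)
  with underdetermined k (λ i t → A zero j *ᶻ A (suc i) (punchIn j t) +ᶻ (-ᶻ A (suc i) j) *ᶻ A zero (punchIn j t))
... | z , (t , z≢0) , sol = y , (punchIn j t , y≢0) , solves
  where
  c = A zero j
  rest : Fin (suc k) → Fin (suc k) → ℤ
  rest i t = A i (punchIn j t)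
  y : Fin (suc (suc k)) → ℤ
  -- Scaling by the pivot `c` avoids division: the pivot coordinate then makes row `zero` vanish.
  y = insertAt (λ t → c *ᶻ z t) j (-ᶻ (rest zero · z))
  y-punch : ∀ t → y (punchIn j t) ≡ c *ᶻ z t
  y-punch = insertAt-punchIn (λ t → c *ᶻ z t) j (-ᶻ (rest zero · z))
  y≢0 : y (punchIn j t) ≢ 0ℤ
  y≢0 eq = *ᶻ-nonzero c≢0 z≢0 (trans (sym (y-punch t)) eq)
  expand : ∀ i → A i · y ≡ A i j *ᶻ (-ᶻ (rest zero · z)) +ᶻ c *ᶻ rest i · z
  expand i = begin
    A i · y
      ≡⟨ sum-remove {i = j} (λ t → A i t *ᶻ y t) ⟩
    A i j *ᶻ y j +ᶻ rest i · (λ t → y (punchIn j t))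
      ≡⟨ cong₂ _+ᶻ_ (cong (A i j *ᶻ_) (insertAt-lookup (λ t → c *ᶻ z t) j _)) (·-congʳ (rest i) y-punch) ⟩
    A i j *ᶻ (-ᶻ (rest zero · z)) +ᶻ rest i · (λ t → c *ᶻ z t)
      ≡⟨ cong (A i j *ᶻ (-ᶻ (rest zero · z)) +ᶻ_) (·-scale (rest i) z c) ⟩
    A i j *ᶻ (-ᶻ (rest zero · z)) +ᶻ c *ᶻ rest i · z ∎
  cancel : ∀ c r → c *ᶻ (-ᶻ r) +ᶻ c *ᶻ r ≡ 0ℤ
  cancel = ℤ-Solver.solve-∀
  neg : ∀ a q r → a *ᶻ (-ᶻ q) +ᶻ r ≡ r +ᶻ (-ᶻ a) *ᶻ q
  neg = ℤ-Solver.solve-∀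
  solves : ∀ i → A i · y ≡ 0ℤ
  solves zero    = trans (expand zero) (cancel c (rest zero · z))
  solves (suc i) = begin
    A (suc i) · y
      ≡⟨ expand (suc i) ⟩
    A (suc i) j *ᶻ (-ᶻ (rest zero · z)) +ᶻ c *ᶻ rest (suc i) · z
      ≡⟨ neg (A (suc i) j) (rest zero · z) (c *ᶻ rest (suc i) · z) ⟩
    c *ᶻ rest (suc i) · z +ᶻ (-ᶻ A (suc i) j) *ᶻ rest zero · z
      ≡⟨ cong₂ _+ᶻ_ (pull c (rest (suc i))) (pull (-ᶻ A (suc i) j) (rest zero)) ⟨
    (λ t → c *ᶻ rest (suc i) t) · z +ᶻ (λ t → (-ᶻ A (suc i) j) *ᶻ rest zero t) · z
      ≡⟨ ∑-distrib-+ (λ t → c *ᶻ rest (suc i) t *ᶻ z t) (λ t → (-ᶻ A (suc i) j) *ᶻ rest zero t *ᶻ z t) ⟨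
    sum (λ t → c *ᶻ rest (suc i) t *ᶻ z t +ᶻ (-ᶻ A (suc i) j) *ᶻ rest zero t *ᶻ z t)
      ≡⟨ sum-cong-≗ (λ t → ℤₚ.*-distribʳ-+ (z t) (c *ᶻ rest (suc i) t) ((-ᶻ A (suc i) j) *ᶻ rest zero t)) ⟨
    (λ t → c *ᶻ rest (suc i) t +ᶻ (-ᶻ A (suc i) j) *ᶻ rest zero t) · z
      ≡⟨ sol i ⟩
    0ℤ ∎
    where
    pull : ∀ c r → (λ t → c *ᶻ r t) · z ≡ c *ᶻ r · z
    pull c r = trans (sum-cong-≗ λ t → ℤₚ.*-assoc c (r t) (z t)) (sym (*-distribˡ-sum c (λ t → r t *ᶻ z t)))

-- Counting with 0/1 vectors

bit : Bool → ℤ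
bit true  = 1ℤ
bit false = 0ℤ

bit-∧ : ∀ a b → bit a *ᶻ bit b ≡ bit (a ∧ b)
bit-∧ true  b = ℤₚ.*-identityˡ (bit b)
bit-∧ false b = ℤₚ.*-zeroˡ (bit b)

sum-empty : ∀ {n} (P : VSet n) → (∀ i → i ∉ P) → sum (bit ∘ P) ≡ 0ℤ
sum-empty {n} P none = trans (sum-cong-≗ λ i → off (P i) (none i)) (sum-replicate-zero n)
  where
  off : ∀ b → ¬ T b → bit b ≡ 0ℤ
  off true  ¬t = ⊥-elim (¬t tt)
  off false _  = refl

sum-single : ∀ {n} (P : VSet n) {i} → i ∈ P → (∀ j → j ∈ P → j ≡ i) → sum (bit ∘ P) ≡ 1ℤ
sum-single {suc n} P {i} i∈ only = trans (sum-remove {i = i} (bit ∘ P))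
  (cong₂ _+ᶻ_ (on (P i) i∈) (sum-empty (P ∘ punchIn i) λ j j∈ → punchInᵢ≢i i j (only _ j∈)))
  where
  on : ∀ b → T b → bit b ≡ 1ℤ
  on true _ = refl

count : ∀ {n} → VSet n → ℕ
count {zero}  P = 0
count {suc n} P with P zero
... | true  = suc (count (P ∘ suc))
... | false = count (P ∘ suc)

sum-count : ∀ {n} (P : VSet n) → sum (bit ∘ P) ≡ pos (count P)
sum-count {zero}  P = refl
sum-count {suc n} P with P zero
... | true  = cong (1ℤ +ᶻ_) (sum-count (P ∘ suc))
... | false = trans (ℤₚ.+-identityˡ _) (sum-count (P ∘ suc))

count≡0 : ∀ {n} (P : VSet n) → count P ≡ 0 → ∀ i → i ∉ P
count≡0 {suc n} P eq i i∈ with P zero in eq₀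
count≡0 {suc n} P eq zero    i∈ | false = subst T eq₀ i∈
count≡0 {suc n} P eq (suc i) i∈ | false = count≡0 (P ∘ suc) eq i i∈

count≡1 : ∀ {n} (P : VSet n) → count P ≡ 1 → ∃[ i ] (i ∈ P × ∀ j → j ∈ P → j ≡ i)
count≡1 {suc n} P eq with P zero in eq₀
... | true  = zero , subst T (sym eq₀) tt , only
  where
  only : ∀ j → j ∈ P → j ≡ zero
  only zero    _  = refl
  only (suc j) j∈ = ⊥-elim (count≡0 (P ∘ suc) (ℕₚ.suc-injective eq) j j∈)
... | false with i , i∈ , only ← count≡1 (P ∘ suc) eq = suc i , i∈ , only′
  where
  only′ : ∀ j → j ∈ P → j ≡ suc i
  only′ zero    j∈ = ⊥-elim (subst T eq₀ j∈)
  only′ (suc j) j∈ = cong suc (only j j∈)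

sum-const : ∀ n c → sum {n} (λ _ → c) ≡ pos n *ᶻ c
sum-const zero    c = sym (ℤₚ.*-zeroˡ c)
sum-const (suc n) c = trans (cong (c +ᶻ_) (sum-const n c)) (sym (ℤₚ.suc-* (pos n) c))

δ : ∀ {n} → Fin n → Fin n → ℤ
δ z v = bit (does (z ≟ v))

δ-refl : ∀ {n} (z : Fin n) → δ z z ≡ 1ℤ
δ-refl z with z ≟ z
... | yes _  = refl
... | no z≢z = ⊥-elim (z≢z refl)

δ-apart : ∀ {n} {z v : Fin n} → z ≢ v → δ z v ≡ 0ℤ
δ-apart {z = z} {v} z≢v with z ≟ v
... | yes z≡v = ⊥-elim (z≢v z≡v)
... | no _    = refl

δ-· : ∀ {n} (z : Fin n) b → δ z · b ≡ b z
δ-· {suc n} z b = begin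
  δ z · b
    ≡⟨ sum-remove {i = z} (λ v → δ z v *ᶻ b v) ⟩
  δ z z *ᶻ b z +ᶻ sum (λ j → δ z (punchIn z j) *ᶻ b (punchIn z j))
    ≡⟨ cong₂ _+ᶻ_ (trans (cong (_*ᶻ b z) (δ-refl z)) (ℤₚ.*-identityˡ (b z)))
         (trans (sum-cong-≗ λ j → trans (cong (_*ᶻ b (punchIn z j)) (δ-apart (punchInᵢ≢i z j ∘ sym)))
                                               (ℤₚ.*-zeroˡ (b (punchIn z j))))
                (sum-replicate-zero n)) ⟩
  b z +ᶻ 0ℤ
    ≡⟨ ℤₚ.+-identityʳ (b z) ⟩
  b z ∎

·-comm : ∀ {n} (a b : Fin n → ℤ) → a · b ≡ b · a
·-comm a b = sum-cong-≗ λ j → ℤₚ.*-comm (a j) (b j)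

-- In matrix form the hypotheses read M S = J − I, where M = A + I for the adjacency matrix A
-- and S has the indicator vectors of the sets S v as columns; the aim is S M = J − I.
module Dual {n} (D : Digraph n) (outsemi : LocallyOutSemicomplete D) (sys : KernelSystem D)
            (N : ℤ) (1+N : 1ℤ +ᶻ N ≡ pos n) (N≢0 : N ≢ 0ℤ) where
  open KernelSystem sys

  self∉ : ∀ v → v ∉ S v
  self∉ v v∈ = indep v (f∈ v) v∈ (f→ v)

  closed : Fin n → VSet n
  closed z w = does (z ≟ w) ∨ adj D z w

  M s : Fin n → Fin n → ℤ
  M z w = bit (closed z w)
  s v w = bit (S v w)

  closed⇒ : ∀ {z w} (b : Bool) → T (closed z w ∧ b) → (z ≡ w ⊎ Arc D z w) × T b
  closed⇒ {z} {w} b p with z ≟ w | adj D z w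
  ... | yes z≡w | _    = inj₁ z≡w , p
  ... | no _    | true = inj₂ tt , p

  closed⇐ : ∀ {z w} (b : Bool) → z ≡ w ⊎ Arc D z w → T b → T (closed z w ∧ b)
  closed⇐ {z} {w} true (inj₁ z≡w) _ with z ≟ w
  ... | yes _  = tt
  ... | no z≢w = ⊥-elim (z≢w z≡w)
  closed⇐ {z} {w} true (inj₂ z→w) _ with z ≟ w | adj D z w
  ... | yes _ | _    = tt
  ... | no _  | true = tt

  -- The closed out-neighbourhood of `z` meets `S v` in nothing if `z = v`, in `z` alone if
  -- `z ∈ S v`, and otherwise in one absorber, since two would be adjacent by local
  -- out-semicompleteness.
  exact : ∀ z v → M z · s v +ᶻ δ z v ≡ 1ℤ
  exact z v = trans (cong (_+ᶻ δ z v) (sum-cong-≗ λ w → bit-∧ (closed z w) (S v w))) total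
    where
    P : VSet n
    P w = closed z w ∧ S v w
    total : sum (bit ∘ P) +ᶻ δ z v ≡ 1ℤ
    total with z ≟ v
    ... | yes refl = cong (_+ᶻ 1ℤ) (sum-empty P λ w → unmet w ∘ closed⇒ (S v w))
      where
      unmet : ∀ w → ¬ ((v ≡ w ⊎ Arc D v w) × w ∈ S v)
      unmet w (inj₁ refl , w∈) = self∉ v w∈
      unmet w (inj₂ v→w  , w∈) = unabs v w∈ v→w
    ... | no z≢v with T? (S v z)
    ...   | yes z∈ = cong (_+ᶻ 0ℤ) (sum-single P {z} (closed⇐ (S v z) (inj₁ refl) z∈) λ w → only w ∘ closed⇒ (S v w))
      where
      only : ∀ w → (z ≡ w ⊎ Arc D z w) × w ∈ S v → w ≡ z
      only w (inj₁ z≡w , _)  = sym z≡w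
      only w (inj₂ z→w , w∈) = ⊥-elim (indep v z∈ w∈ z→w)
    ...   | no z∉ with a , a∈ , z→a ← absorb v z≢v z∉ =
      cong (_+ᶻ 0ℤ) (sum-single P {a} (closed⇐ (S v a) (inj₂ z→a) a∈) λ w → only w ∘ closed⇒ (S v w))
      where
      only : ∀ w → (z ≡ w ⊎ Arc D z w) × w ∈ S v → w ≡ a
      only w (inj₁ refl , w∈) = ⊥-elim (z∉ w∈)
      only w (inj₂ z→w  , w∈) with w ≟ a
      ... | yes w≡a = w≡a
      ... | no w≢a with outsemi z w a z→w z→a w≢a
      ...   | inj₁ w→a = ⊥-elim (indep v w∈ a∈ w→a)
      ...   | inj₂ a→w = ⊥-elim (indep v a∈ w∈ a→w)

  combination : ∀ z b → (λ v → M z · s v) · b +ᶻ b z ≡ sum b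
  combination z b = begin
    (λ v → M z · s v) · b +ᶻ b z
      ≡⟨ cong ((λ v → M z · s v) · b +ᶻ_) (δ-· z b) ⟨
    (λ v → M z · s v) · b +ᶻ δ z · b
      ≡⟨ ∑-distrib-+ (λ v → M z · s v *ᶻ b v) (λ v → δ z v *ᶻ b v) ⟨
    sum (λ v → M z · s v *ᶻ b v +ᶻ δ z v *ᶻ b v)
      ≡⟨ sum-cong-≗ (λ v → trans (sym (ℤₚ.*-distribʳ-+ (b v) (M z · s v) (δ z v)))
           (trans (cong (_*ᶻ b v) (exact z v)) (ℤₚ.*-identityˡ (b v)))) ⟩
    sum b ∎

  N-torsion : ∀ B → B ≡ pos n *ᶻ B → B ≡ 0ℤ
  N-torsion B eq = nonzero-factor {B} {N} N≢0 (begin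
    B *ᶻ N                      ≡⟨ peel N B ⟩
    (1ℤ +ᶻ N) *ᶻ B +ᶻ -ᶻ B      ≡⟨ cong (λ c → c *ᶻ B +ᶻ -ᶻ B) 1+N ⟩
    pos n *ᶻ B +ᶻ -ᶻ B            ≡⟨ cong (_+ᶻ -ᶻ B) eq ⟨
    B +ᶻ -ᶻ B                   ≡⟨ ℤₚ.+-inverseʳ B ⟩
    0ℤ                          ∎)
    where
    peel : ∀ N B → B *ᶻ N ≡ (1ℤ +ᶻ N) *ᶻ B +ᶻ -ᶻ B
    peel = ℤ-Solver.solve-∀

  -- The `n` by `n + 1` matrix with columns `x` and all `s v` has a nonzero null vector `(a, b)`.
  -- Applying `M` gives `(J − I) b = 0`, so `b` is constant and, as `n ≠ 1`, zero. Hence `a ≠ 0` and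
  -- `a x = 0`.
  M-injective : ∀ x → (∀ z → M z · x ≡ 0ℤ) → ∀ w → x w ≡ 0ℤ
  M-injective x Mx≡0 with underdetermined n A
    where
    A : Fin n → Fin (suc n) → ℤ
    A w zero    = x w
    A w (suc v) = s v w
  ... | y , nonzero , sol = λ w → nonzero-factor (a≢0 nonzero) (begin
    x w *ᶻ a                              ≡⟨ ℤₚ.+-identityʳ _ ⟨
    x w *ᶻ a +ᶻ 0ℤ                        ≡⟨ cong (x w *ᶻ a +ᶻ_) (trans (·-congʳ (λ v → s v w) b≡0) (·-zeroʳ (λ v → s v w))) ⟨
    x w *ᶻ a +ᶻ (λ v → s v w) · b         ≡⟨ sol w ⟩
    0ℤ                                    ∎)
    where
    a = y zero
    b : Fin n → ℤ
    b v = y (suc v)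
    image : ∀ z → (λ v → M z · s v) · b ≡ 0ℤ
    image z = begin
      (λ v → M z · s v) · b
        ≡⟨ ·-assoc (M z) s b ⟨
      M z · (λ w → (λ v → s v w) · b)
        ≡⟨ ℤₚ.+-identityˡ _ ⟨
      0ℤ +ᶻ M z · (λ w → (λ v → s v w) · b)
        ≡⟨ cong (_+ᶻ M z · (λ w → (λ v → s v w) · b)) (trans (cong (a *ᶻ_) (Mx≡0 z)) (ℤₚ.*-zeroʳ a)) ⟨
      a *ᶻ M z · x +ᶻ M z · (λ w → (λ v → s v w) · b)
        ≡⟨ cong (_+ᶻ M z · (λ w → (λ v → s v w) · b)) (·-scale (M z) x a) ⟨
      M z · (λ w → a *ᶻ x w) +ᶻ M z · (λ w → (λ v → s v w) · b)
        ≡⟨ ·-+ (M z) (λ w → a *ᶻ x w) (λ w → (λ v → s v w) · b) ⟨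
      M z · (λ w → a *ᶻ x w +ᶻ (λ v → s v w) · b)
        ≡⟨ ·-congʳ (M z) (λ w → trans (cong (_+ᶻ (λ v → s v w) · b) (ℤₚ.*-comm a (x w))) (sol w)) ⟩
      M z · (λ _ → 0ℤ)
        ≡⟨ ·-zeroʳ (M z) ⟩
      0ℤ ∎
    b≡sum : ∀ z → b z ≡ sum b
    b≡sum z = trans (sym (ℤₚ.+-identityˡ (b z))) (trans (cong (_+ᶻ b z) (sym (image z))) (combination z b))
    b≡0 : ∀ z → b z ≡ 0ℤ
    b≡0 z = trans (b≡sum z) (N-torsion (sum b) (trans (sum-cong-≗ b≡sum) (sum-const n (sum b))))
    a≢0 : ∃[ j ] y j ≢ 0ℤ → a ≢ 0ℤ
    a≢0 (zero  , ≢0) a≡0 = ≢0 a≡0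
    a≢0 (suc v , ≢0) _   = ≢0 (b≡0 v)

  d σ : Fin n → ℤ
  d w = sum λ v → M v w
  σ u = sum λ v → s v u

  Meets : Fin n → Fin n → VSet n
  Meets u w v = closed v w ∧ S v u

  cnt : Fin n → Fin n → ℤ
  cnt u w = (λ v → s v u) · (λ v → M v w)

  cnt-count : ∀ u w → cnt u w ≡ pos (count (Meets u w))
  cnt-count u w = trans (sum-cong-≗ λ v → trans (ℤₚ.*-comm (s v u) (M v w)) (bit-∧ (closed v w) (S v u)))
                        (sum-count (Meets u w))

  -- In matrix form `N (S M + I) = σ dᵀ`. Column `w` of the difference of the two sides is
  -- annihilated by `M`, hence zero by `M-injective`.
  count-equation : ∀ u w → N *ᶻ δ w u +ᶻ N *ᶻ cnt u w ≡ d w *ᶻ σ u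
  count-equation u w = begin
    N *ᶻ δ w u +ᶻ N *ᶻ cnt u w
      ≡⟨ add-sub (N *ᶻ δ w u) (N *ᶻ cnt u w) (d w) (σ u) ⟩
    N *ᶻ δ w u +ᶻ (N *ᶻ cnt u w +ᶻ (-ᶻ d w) *ᶻ σ u) +ᶻ d w *ᶻ σ u
      ≡⟨ cong (_+ᶻ d w *ᶻ σ u) (trans (cong (N *ᶻ δ w u +ᶻ_) (sym (expand u))) (M-injective x kills u)) ⟩
    0ℤ +ᶻ d w *ᶻ σ u
      ≡⟨ ℤₚ.+-identityˡ _ ⟩
    d w *ᶻ σ u ∎
    where
    b x : Fin n → ℤ
    -- Chosen so that `(J − I) b` is `−N` times column `w` of `M`; the constant `d w` achieves this
    -- because `n = 1 + N`.
    b v = N *ᶻ M v w +ᶻ -ᶻ d w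
    x u = N *ᶻ δ w u +ᶻ (λ v → s v u) · b

    add-sub : ∀ p q e t → p +ᶻ q ≡ p +ᶻ (q +ᶻ (-ᶻ e) *ᶻ t) +ᶻ e *ᶻ t
    add-sub = ℤ-Solver.solve-∀

    expand : ∀ u → (λ v → s v u) · b ≡ N *ᶻ cnt u w +ᶻ (-ᶻ d w) *ᶻ σ u
    expand u = trans (·-+ (λ v → s v u) (λ v → N *ᶻ M v w) (λ _ → -ᶻ d w))
      (cong₂ _+ᶻ_ (·-scale (λ v → s v u) (λ v → M v w) N)
        (trans (sym (*-distribʳ-sum (-ᶻ d w) (λ v → s v u))) (ℤₚ.*-comm (σ u) (-ᶻ d w))))

    sum-b : sum b ≡ N *ᶻ d w +ᶻ (1ℤ +ᶻ N) *ᶻ (-ᶻ d w)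
    sum-b = trans (∑-distrib-+ (λ v → N *ᶻ M v w) (λ _ → -ᶻ d w))
      (cong₂ _+ᶻ_ (sym (*-distribˡ-sum N (λ v → M v w)))
                     (trans (sum-const n (-ᶻ d w)) (cong (_*ᶻ (-ᶻ d w)) (sym 1+N))))

    balance : ∀ N m d g → g +ᶻ (N *ᶻ m +ᶻ -ᶻ d) ≡ N *ᶻ d +ᶻ (1ℤ +ᶻ N) *ᶻ (-ᶻ d) → N *ᶻ m +ᶻ g ≡ 0ℤ
    balance N m d g eq = trans (left N m d g) (trans (cong (_+ᶻ d) eq) (right N d))
      where
      left : ∀ N m d g → N *ᶻ m +ᶻ g ≡ g +ᶻ (N *ᶻ m +ᶻ -ᶻ d) +ᶻ d
      left = ℤ-Solver.solve-∀
      right : ∀ N d → N *ᶻ d +ᶻ (1ℤ +ᶻ N) *ᶻ (-ᶻ d) +ᶻ d ≡ 0ℤ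
      right = ℤ-Solver.solve-∀

    kills : ∀ z → M z · x ≡ 0ℤ
    kills z = begin
      M z · x
        ≡⟨ ·-+ (M z) (λ u → N *ᶻ δ w u) (λ u → (λ v → s v u) · b) ⟩
      M z · (λ u → N *ᶻ δ w u) +ᶻ M z · (λ u → (λ v → s v u) · b)
        ≡⟨ cong₂ _+ᶻ_ (trans (·-scale (M z) (δ w) N) (cong (N *ᶻ_) (trans (·-comm (M z) (δ w)) (δ-· w (M z)))))
                      (·-assoc (M z) s b) ⟩
      N *ᶻ M z w +ᶻ (λ v → M z · s v) · b
        ≡⟨ balance N (M z w) (d w) _ (trans (combination z b) sum-b) ⟩
      0ℤ ∎

  diagonal : ∀ u → d u *ᶻ σ u ≡ N
  diagonal u = begin
    d u *ᶻ σ u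
      ≡⟨ count-equation u u ⟨
    N *ᶻ δ u u +ᶻ N *ᶻ cnt u u
      ≡⟨ cong₂ (λ p q → N *ᶻ p +ᶻ N *ᶻ q) (δ-refl u) (trans (sum-cong-≗ λ v →
           trans (ℤₚ.*-comm (s v u) (M v u)) (bit-∧ (closed v u) (S v u))) (sum-empty (Meets u u) λ v → unmet v ∘ closed⇒ (S v u))) ⟩
    N *ᶻ 1ℤ +ᶻ N *ᶻ 0ℤ
      ≡⟨ unit N ⟩
    N ∎
    where
    unmet : ∀ v → ¬ ((v ≡ u ⊎ Arc D v u) × u ∈ S v)
    unmet v (inj₁ refl , u∈) = self∉ v u∈
    unmet v (inj₂ v→u  , u∈) = unabs v u∈ v→u
    unit : ∀ N → N *ᶻ 1ℤ +ᶻ N *ᶻ 0ℤ ≡ N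
    unit = ℤ-Solver.solve-∀

  d≢0 : ∀ u → d u ≢ 0ℤ
  d≢0 u d≡0 = N≢0 (trans (sym (diagonal u)) (trans (cong (_*ᶻ σ u) d≡0) (ℤₚ.*-zeroˡ (σ u))))

  σ≢0 : ∀ u → σ u ≢ 0ℤ
  σ≢0 u σ≡0 = N≢0 (trans (sym (diagonal u)) (trans (cong (d u *ᶻ_) σ≡0) (ℤₚ.*-zeroʳ (d u))))

  cancelʳ : ∀ i j {k} → k ≢ 0ℤ → i *ᶻ k ≡ j *ᶻ k → i ≡ j
  cancelʳ i j {k} k≢0 = ℤₚ.*-cancelʳ-≡ i j k {{≢-nonZero k≢0}}

  degree-ratio : ∀ {u w} → u ≢ w → d u *ᶻ cnt u w ≡ d w
  degree-ratio {u} {w} u≢w = cancelʳ (d u *ᶻ cnt u w) (d w) (σ≢0 u) (begin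
    d u *ᶻ cnt u w *ᶻ σ u          ≡⟨ swap (d u) (cnt u w) (σ u) ⟩
    d u *ᶻ σ u *ᶻ cnt u w          ≡⟨ cong (_*ᶻ cnt u w) (diagonal u) ⟩
    N *ᶻ cnt u w                   ≡⟨ ℤₚ.+-identityˡ _ ⟨
    0ℤ +ᶻ N *ᶻ cnt u w             ≡⟨ cong (_+ᶻ N *ᶻ cnt u w) (trans (cong (N *ᶻ_) (δ-apart (u≢w ∘ sym))) (ℤₚ.*-zeroʳ N)) ⟨
    N *ᶻ δ w u +ᶻ N *ᶻ cnt u w     ≡⟨ count-equation u w ⟩
    d w *ᶻ σ u                     ∎)
    where
    swap : ∀ p q r → p *ᶻ q *ᶻ r ≡ p *ᶻ r *ᶻ q
    swap = ℤ-Solver.solve-∀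

  -- By `degree-ratio`, `cnt u w` is the quotient of `d w` by `d u`, and `cnt w u` is the inverse
  -- quotient.
  reciprocal : ∀ {u w} → u ≢ w → cnt u w *ᶻ cnt w u ≡ 1ℤ
  reciprocal {u} {w} u≢w = cancelʳ (cnt u w *ᶻ cnt w u) 1ℤ (d≢0 u) (begin
    cnt u w *ᶻ cnt w u *ᶻ d u    ≡⟨ swap (cnt u w) (cnt w u) (d u) ⟩
    d u *ᶻ cnt u w *ᶻ cnt w u    ≡⟨ cong (_*ᶻ cnt w u) (degree-ratio u≢w) ⟩
    d w *ᶻ cnt w u               ≡⟨ degree-ratio (u≢w ∘ sym) ⟩
    d u                          ≡⟨ ℤₚ.*-identityˡ (d u) ⟨
    1ℤ *ᶻ d u                    ∎)
    where
    swap : ∀ p q r → p *ᶻ q *ᶻ r ≡ r *ᶻ p *ᶻ q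
    swap = ℤ-Solver.solve-∀

  -- Two natural numbers with product 1 are both 1. This is the off-diagonal part of `S M = J − I`.
  meets-once : ∀ {u w} → u ≢ w → count (Meets u w) ≡ 1
  meets-once {u} {w} u≢w = ℕₚ.m*n≡1⇒m≡1 a b (ℤₚ.+-injective (begin
    pos (a * b)             ≡⟨ ℤₚ.pos-* a b ⟩
    pos a *ᶻ pos b            ≡⟨ cong₂ _*ᶻ_ (cnt-count u w) (cnt-count w u) ⟨
    cnt u w *ᶻ cnt w u    ≡⟨ reciprocal u≢w ⟩
    1ℤ                    ∎))
    where
    a = count (Meets u w)
    b = count (Meets w u)

  meeting : ∀ {u w} → u ≢ w → ∃[ v ] (v ∈ Meets u w × ∀ v′ → v′ ∈ Meets u w → v′ ≡ v)
  meeting {u} {w} u≢w = count≡1 (Meets u w) (meets-once u≢w)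

  -- Both `a` and `b` would lie in `Meets u a`, which has a single element.
  dualIndep : ∀ u {a b} → u ∈ S a → u ∈ S b → ¬ Arc D b a
  dualIndep u {a} {b} u∈a u∈b b→a = loop-free D b→a
    (trans (only b (closed⇐ (S b u) (inj₂ b→a) u∈b)) (sym (only a (closed⇐ (S a u) (inj₁ refl) u∈a))))
    where
    u≢a : u ≢ a
    u≢a refl = self∉ u u∈a
    only : ∀ v → v ∈ Meets u a → v ≡ proj₁ (meeting u≢a)
    only = proj₂ (proj₂ (meeting u≢a))

  -- Two out-neighbours of `f v` would be adjacent, against `dualIndep`. Thus `f` is a bijection,
  -- and its inverse serves as the `f` of the dual system.
  f-injective : ∀ {v v′} → f v ≡ f v′ → v ≡ v′
  f-injective {v} {v′} eq with v ≟ v′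
  ... | yes v≡v′ = v≡v′
  ... | no v≢v′ with outsemi (f v) v v′ (f→ v) (subst (λ z → Arc D z v′) (sym eq) (f→ v′)) v≢v′
  ...   | inj₁ v→v′ = ⊥-elim (dualIndep (f v) (subst (_∈ S v′) (sym eq) (f∈ v′)) (f∈ v) v→v′)
  ...   | inj₂ v′→v = ⊥-elim (dualIndep (f v) (f∈ v) (subst (_∈ S v′) (sym eq) (f∈ v′)) v′→v)

  f-onto : ∀ u → ∃[ v ] f v ≡ u
  f-onto = injective⇒surjective f f-injective

  dualSystem : KernelSystem (reverse D)
  dualSystem = record
    { S = λ u v → S v u
    ; f = proj₁ ∘ f-onto
    ; indep = dualIndep
    ; unabs = λ u {t} u∈ t→u → unabs t u∈ t→u
    ; absorb = λ u w≢u w∉ → let v , v∈ , _ = meeting (w≢u ∘ sym) in met w∉ (closed⇒ (S v u) v∈)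
    ; f∈ = λ u → let v , eq = f-onto u in subst (_∈ S v) eq (f∈ v)
    ; f→ = λ u → let v , eq = f-onto u in subst (λ z → Arc D z v) eq (f→ v) }
    where
    met : ∀ {u w v} → ¬ u ∈ S w → (v ≡ w ⊎ Arc D v w) × u ∈ S v → ∃[ t ] (u ∈ S t × Arc D t w)
    met w∉ (inj₁ refl , u∈) = ⊥-elim (w∉ u∈)
    met w∉ (inj₂ v→w  , u∈) = _ , u∈ , v→w

theorem7 : ∀ {n} (D : Digraph n) →
    (LocallyInSemicomplete D ⊎ LocallyOutSemicomplete D) → CKI D →
    IsDirectedOddCycle D ⊎ IsoCirc D 7 J-1-2 ⊎ (∃[ m ] (4 ≤ m × IsoCirc D m (J-big m)))
theorem7 D (inj₁ insemi) cki =
  classify D cki (obstruction D insemi (cki⇒kernelSystem D cki) (cki⇒inhabited D cki))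
theorem7 {zero} D (inj₂ _) cki = ⊥-elim (¬Fin0 (cki⇒inhabited D cki))
-- The duality divides by `N = n − 1`, so `n = 1` is treated apart: the only vertex would be its own
-- in-neighbour.
theorem7 {suc zero} D (inj₂ _) cki with f zero | f→ zero
  where open KernelSystem (cki⇒kernelSystem D cki)
... | zero | loop = ⊥-elim (loop-free D loop refl)
theorem7 {suc (suc n₀)} D (inj₂ outsemi) cki = classify D cki (reverseObstruction D
  (obstruction (reverse D) (λ v x y v→x v→y x≢y → Sum.swap (outsemi v x y v→x v→y x≢y)) dualSystem zero))
  where open Dual D outsemi (cki⇒kernelSystem D cki) (pos (suc n₀)) refl (λ ())
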